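{- There is an absolute constant $C>0$ such that for all positive integers $\ell$ and $k$, the algorithm COMP (in the variant where each remapping event is handled in a way minimizing the number of affected clusters) for the online balanced graph repartitioning problem with $\ell$ clusters of capacity $k$ is $(\ell\cdot 2^{Ck})$-competitive; that is, COMP is $(\ell\cdot 2^{O(k)})$-competitive.
   Context: Problem (online balanced graph repartitioning). There are $n=\ell\cdot k$ nodes and $\ell$ clusters. A mapping of nodes to clusters is valid if each cluster contains exactly $k$ nodes. The offline part of the input is the set of nodes together with an initial valid mapping. The online part is a finite sequence of requests, each being a pair of nodes $(u,v)$. A request incurs cost $1$ if $u$ and $v$ are currently mapped to different clusters, and $0$ otherwise. After each request, an algorithm may change the current mapping to another valid mapping, paying $1$ for each node that changes its cluster. An online algorithm makes its decisions irrevocably after each request, without knowledge of future requests. Competitiveness. For an input $I$, $\mathrm{ALG}(I)$ is the cost of algorithm ALG on $I$, and $\mathrm{OPT}(I)$ is the optimal cost of an offline solution (starting from the same initial valid mapping). ALG is $\gamma$-competitive if there is a constant $\beta$ such that $\mathrm{ALG}(I)\le\gamma\cdot\mathrm{OPT}(I)+\beta$ for every input $I$; $\beta$ must be independent of the online part of the input but may depend on $\ell$ and $k$. Algorithm COMP. COMP works in phases. In each phase it maintains a partition $\mathcal R$ of the set of nodes into components; at the beginning of each phase every node is its own singleton component. It maintains the component invariant: for each component $S\in\mathcal R$, all nodes of $S$ are in the same cluster. When a request $(u,v)$ arrives: - If $u$ and $v$ are in the same component of $\mathcal R$, COMP does nothing (and pays nothing). - If $u$ and $v$ are in different components $S_a$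 and $S_b$, COMP replaces $S_a$ and $S_b$ in $\mathcal R$ by $S_{ab}=S_a\uplus S_b$. If $S_a$ and $S_b$ were in the same cluster, nothing else happens. If they were in different clusters, COMP checks whether there is a valid mapping of nodes to clusters satisfying the component invariant for the new $\mathcal R$. If so, a remapping event occurs: among all such mappings, COMP chooses one minimizing the number of affected clusters (clusters that some node leaves or enters, when passing from the current mapping to the new one), ties being broken arbitrarily, and changes to it. If no such valid mapping exists, COMP resets $\mathcal R$ to the partition into singletons and starts a new phase (keeping its current mapping). -}

module Defs where

open import Data.Bool using (if_then_else_)
open import Data.Fin using (Fin; _≟_)
open import Data.Fin.Properties using (any?; all?)
open import Data.List as List using (List; []; _∷_)
import Data.List.Extrema
open import Data.List.Membership.Propositional using (_∈_)
open import Data.List.Membership.Propositional.Properties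
  using (∈-cartesianProductWith⁺; ∈-allFin; ∈-filter⁺; ∈-filter⁻)
import Data.List.Relation.Unary.All as ListAll
open import Data.List.Relation.Unary.Any using (here)
open import Data.Nat using (ℕ; zero; suc; _+_; _*_; _≤_; z≤n)
open import Data.Nat.Properties using (≤-trans; ≤-totalOrder; +-monoʳ-≤)
import Data.Nat as Nat
open import Data.Product using (∃; ∃-syntax; _×_; _,_; proj₁; proj₂)
open import Data.Sum using (_⊎_; inj₁; inj₂)
open import Data.Vec using (Vec; []; _∷_; lookup; count; allFin)
open import Data.Vec.Relation.Unary.All using (All; []; _∷_)
open import Function using (id)
open import Level using (0ℓ)
open import Relation.Binary.PropositionalEquality using (_≡_; _≢_; refl)
open import Relation.Nullary using (¬_; yes; no; does; contradiction)
open import Relation.Nullary.Decidable using (¬?; _×-dec_; _⊎-dec_; _→-dec_)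
open import Relation.Unary using (Pred; Decidable)

allVecs : (m n : ℕ) → List (Vec (Fin m) n)
allVecs m zero    = [] ∷ []
allVecs m (suc n) = List.cartesianProductWith _∷_ (List.allFin m) (allVecs m n)

∈-allVecs : ∀ {m n} (v : Vec (Fin m) n) → v ∈ allVecs m n
∈-allVecs []      = here refl
∈-allVecs (x ∷ v) = ∈-cartesianProductWith⁺ _∷_ (∈-allFin x) (∈-allVecs v)

Minimises : ∀ {A : Set} → (A → ℕ) → Pred A 0ℓ → A → Set
Minimises f P x = P x × (∀ y → P y → f x ≤ f y)

minimise : ∀ {m n} (f : Vec (Fin m) n → ℕ) {P : Pred (Vec (Fin m) n) 0ℓ} → Decidable P →
           ∃ (Minimises f P) ⊎ ¬ ∃ P
minimise {m} {n} f {P} P? with List.filter P? (allVecs m n)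
                             | (λ {v} → ∈-filter⁻ P? {v} {allVecs m n})
                             | (λ {v} → ∈-filter⁺ P? {v} {allVecs m n})
... | []     | _     | complete = inj₂ λ (v , p) → case-[] (complete (∈-allVecs v) p)
  where
  case-[] : ∀ {v : Vec (Fin m) n} → ¬ (v ∈ [])
  case-[] ()
... | x ∷ xs | sound | complete =
  inj₁ (best
       , argmin-all f {P = P} (proj₂ (sound (here refl)))
           (ListAll.tail (ListAll.tabulate {xs = x ∷ xs} λ v∈ → proj₂ (sound v∈)))
       , λ v p → ListAll.lookup {P = λ y → f best ≤ f y}
                   (f[argmin]≤f[⊤] {f = f} x xs ListAll.∷ f[argmin]≤f[xs] {f = f} x xs)
                   (complete (∈-allVecs v) p))
  where
  open Data.List.Extrema ≤-totalOrder
  best = argmin f x xs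

module _ (ℓ k : ℕ) where

  Node Cluster Request Mapping : Set
  Node    = Fin (ℓ * k)
  Cluster = Fin ℓ
  Request = Node × Node
  Mapping = Vec Cluster (ℓ * k)

  Valid : Mapping → Set
  Valid M = ∀ c → count (_≟ c) M ≡ k

  valid? : Decidable Valid
  valid? M = all? λ c → count (_≟ c) M Nat.≟ k

  requestCost : Mapping → Request → ℕ
  requestCost M (u , v) = if does (lookup M u ≟ lookup M v) then 0 else 1

  migrationCost : Mapping → Mapping → ℕ
  migrationCost M M′ = count (λ u → ¬? (lookup M u ≟ lookup M′ u)) (allFin (ℓ * k))

  -- The i-th entry of the last argument is the mapping in force after the
  -- decision following the i-th request; a request is charged before it.
  cost : ∀ {T} → Mapping → Vec Request T → Vec Mapping T → ℕ
  cost M []       []        = 0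
  cost M (r ∷ rs) (M′ ∷ Ms) = requestCost M r + migrationCost M M′ + cost M′ rs Ms

  record Input : Set where
    field
      initial       : Mapping
      initial-valid : Valid initial
      {len}         : ℕ
      requests      : Vec Request len

  IsOptimalCost : ∀ {T} → Mapping → Vec Request T → ℕ → Set
  IsOptimalCost {T} M rs o =
    (∃[ Ms ] All Valid Ms × cost M rs Ms ≡ o) ×
    (∀ (Ms : Vec Mapping T) → All Valid Ms → o ≤ cost M rs Ms)

  optimalCost : ∀ {T} M → Valid M → (rs : Vec Request T) → ∃ (IsOptimalCost M rs)
  optimalCost M₀ v₀ = go M₀
    where
    go : ∀ {T} M → (rs : Vec Request T) → ∃ (IsOptimalCost M rs)
    go M [] = 0 , ([] , [] , refl) , λ _ _ → z≤n
    go M (r ∷ rs) with minimise (λ M′ → requestCost M r + migrationCost M M′ + proj₁ (go M′ rs)) valid?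
    ... | inj₂ none = contradiction (M₀ , v₀) none
    ... | inj₁ (M′ , v′ , least) with go M′ rs
    ...   | o , (Ms , vs , refl) , _ =
      _ , (M′ ∷ Ms , v′ ∷ vs , refl) ,
      λ { (N ∷ Ns) (w ∷ ws) →
            ≤-trans (least N w)
                    (+-monoʳ-≤ (requestCost M r + migrationCost M N) (proj₂ (proj₂ (go N rs)) Ns ws)) }

  OPT : Input → ℕ
  OPT I = proj₁ (optimalCost initial initial-valid requests)
    where open Input I

  -- Choices the algorithm leaves open (such as ties) make step a relation:
  -- any step it allows may be taken.
  record OnlineAlgorithm : Set₁ where
    field
      State         : Set
      mapping       : State → Mapping
      valid         : ∀ s → Valid (mapping s)
      start         : ∀ M → Valid M → State
      mapping-start : ∀ M v → mapping (start M v) ≡ M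
      step          : State → Request → State → Set
      progress      : ∀ s r → ∃ (step s r)

  module _ (A : OnlineAlgorithm) where
    open OnlineAlgorithm A

    data Run : ∀ {T} → State → Vec Request T → Vec Mapping T → Set where
      []  : ∀ {s} → Run s [] []
      _∷_ : ∀ {T s s′ r} {rs : Vec Request T} {Ms} →
            step s r s′ → Run s′ rs Ms → Run s (r ∷ rs) (mapping s′ ∷ Ms)

    Competitive : ℕ → Set
    Competitive γ = ∃[ β ] ((I : Input) → let open Input I in
      ∀ Ms → Run (start initial initial-valid) requests Ms →
      cost initial requests Ms ≤ γ * OPT I + β)

  -- A partition of the nodes is given by a labelling: two nodes are in the
  -- same component iff they have the same label.
  Partition : Set
  Partition = Node → Node

  singletons : Partition
  singletons = id

  merge : Node → Node → Partition → Partition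
  merge u v R w = if does (R w ≟ R v) then R u else R w

  Invariant : Partition → Mapping → Set
  Invariant R M = ∀ u v → R u ≡ R v → lookup M u ≡ lookup M v

  invariant? : ∀ R → Decidable (Invariant R)
  invariant? R M = all? λ u → all? λ v → (R u ≟ R v) →-dec (lookup M u ≟ lookup M v)

  Affected : Mapping → Mapping → Cluster → Set
  Affected M M′ c =
    ∃[ u ] lookup M u ≢ lookup M′ u × (lookup M u ≡ c ⊎ lookup M′ u ≡ c)

  affected? : ∀ M M′ → Decidable (Affected M M′)
  affected? M M′ c = any? λ u →
    ¬? (lookup M u ≟ lookup M′ u) ×-dec ((lookup M u ≟ c) ⊎-dec (lookup M′ u ≟ c))

  #affected : Mapping → Mapping → ℕ
  #affected M M′ = count (affected? M M′) (allFin ℓ)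

  Admissible : Partition → Mapping → Set
  Admissible R M = Valid M × Invariant R M

  record CompState : Set where
    constructor ⟨_,_,_⟩
    field
      mapping    : Mapping
      valid      : Valid mapping
      components : Partition

  data CompStep : CompState → Request → CompState → Set where
    same-component : ∀ {M p R u v} → R u ≡ R v →
      CompStep ⟨ M , p , R ⟩ (u , v) ⟨ M , p , R ⟩
    same-cluster   : ∀ {M p R u v} → R u ≢ R v → lookup M u ≡ lookup M v →
      CompStep ⟨ M , p , R ⟩ (u , v) ⟨ M , p , merge u v R ⟩
    remap          : ∀ {M p R u v M′ p′} → R u ≢ R v → lookup M u ≢ lookup M v →
      Minimises (#affected M) (Admissible (merge u v R)) M′ →
      CompStep ⟨ M , p , R ⟩ (u , v) ⟨ M′ , p′ , merge u v R ⟩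
    new-phase      : ∀ {M p R u v} → R u ≢ R v → lookup M u ≢ lookup M v →
      ¬ ∃ (Admissible (merge u v R)) →
      CompStep ⟨ M , p , R ⟩ (u , v) ⟨ M , p , singletons ⟩

  comp-progress : ∀ s r → ∃ (CompStep s r)
  comp-progress ⟨ M , p , R ⟩ (u , v) with R u ≟ R v
  ... | yes same = _ , same-component same
  ... | no  diff with lookup M u ≟ lookup M v
  ...   | yes same = _ , same-cluster diff same
  ...   | no  apart with minimise (#affected M) {Admissible (merge u v R)}
                           (λ M′ → valid? M′ ×-dec invariant? (merge u v R) M′)
  ...     | inj₁ (M′ , best) = _ , remap {M′ = M′} {p′ = proj₁ (proj₁ best)} diff apart best
  ...     | inj₂ none       = _ , new-phase diff apart none

  COMP : OnlineAlgorithm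
  COMP = record
    { State         = CompState
    ; mapping       = CompState.mapping
    ; valid         = CompState.valid
    ; start         = λ M p → ⟨ M , p , singletons ⟩
    ; mapping-start = λ _ _ → refl
    ; step          = CompStep
    ; progress      = comp-progress
    }

-- A phase of COMP contains at most ℓk merges, and the offline player pays at
-- least 1 in each finished phase, so it suffices that a remapping event affects only 2^O(k)
-- clusters.  Describe the contents of a cluster by the number of components of
-- each size (disregarding the merged one), and let v_c ∈ ℤᵏ be the difference
-- of the old and the new description of c.  These vectors sum to zero over the
-- affected clusters.  By the Steinitz lemma (Grinberg–Sevastyanov argument)
-- there is a long decreasing chain of sets of clusters whose sums all lie in a
-- ball containing only 2^O(k) lattice points; if more clusters are affected,
-- two sums agree, and the difference of the two sets is a nonempty set T with
-- zero sum.  After exchanging components of equal size, the clusters of T can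
-- keep their old contents, contradicting the minimality of the new mapping.

module Submission where

open import Defs
open import Algebra.Bundles using (AbelianGroup; CommutativeMonoid)
open import Data.Bool as Bool using (Bool; true; false; if_then_else_; _∧_; _∨_; not)
open import Data.Bool.Properties using (∧-zeroʳ; ∨-identityʳ; ∨-zeroʳ)
open import Data.Fin as Fin using (Fin; zero; suc; punchIn; splitAt; _↑ˡ_; _↑ʳ_; _≟_)
open import Data.Fin.Permutation as Perm using (Permutation; _⟨$⟩ʳ_)
open import Data.Fin.Properties using (any?; pigeonhole; splitAt-↑ˡ; splitAt-↑ʳ)
open import Data.Integer as ℤ using (ℤ; +_; -[1+_]; 0ℤ)
import Data.Integer.Properties as ℤₚ
import Data.Integer.Tactic.RingSolver as ℤ-Solver
open import Data.List as List using (List; []; _∷_; _++_; length; cartesianProduct)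
open import Data.List.Membership.Propositional using (_∈_)
open import Data.List.Membership.Propositional.Properties
  using (∈-++⁺ˡ; ∈-++⁺ʳ; ∈-map⁺; ∈-cartesianProduct⁺)
import Data.List.Properties as Listₚ
open import Data.List.Relation.Unary.Any as Any using (here; there)
open import Data.List.Relation.Unary.Any.Properties using (lookup-index)
open import Data.Nat as ℕ using (ℕ; zero; suc; _+_; _*_; _∸_; _^_; _!; _≤_; _<_; z≤n; s≤s)
import Data.Nat.Properties as ℕₚ
import Data.Nat.Tactic.RingSolver as ℕ-Solver
open import Data.Product using (∃-syntax; ∃₂; Σ-syntax; _×_; _,_; proj₁; proj₂)
open import Data.Sum using (_⊎_; inj₁; inj₂; [_,_])
open import Data.Vec as Vec using (Vec; []; _∷_; tabulate; lookup; count)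
open import Data.Vec.Functional using (Vector)
open import Data.Vec.Properties using (lookup∘tabulate; lookup-allFin)
open import Data.Vec.Relation.Unary.All using (All; []; _∷_)
open import Function using (_∘_; mk⇔)
open import Relation.Binary using (DecidableEquality)
open import Relation.Binary.PropositionalEquality hiding ([_])
open import Relation.Nullary using (¬_; Dec; yes; no; does; contradiction)
open import Relation.Nullary.Decidable using (dec-true; dec-false; does-⇔; _×-dec_; ¬?; map′)
open import Relation.Unary using (Pred; Decidable)

import Algebra.Properties.Semiring.Sum as SemiringSum

-- The ball is small only in a norm adapted to the problem. A cluster has k nodes, so the sizes of
-- its components add up to at most k, and a vector v_c has norm at most 2k once the coordinate of
-- size s is weighted by s. The sum of each set in the chain is a combination of the v_c with
-- coefficients in [0,1] of total k, hence of norm at most 2k². In the plain ℓ₁ norm such a ball in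
-- dimension k holds k^Θ(k) points; the weights 1, ..., k divide its volume by k! and leave 2^O(k).
-- The merged component is one block in the new mapping but is split in the old one, so its old
-- place cannot be kept. This is why the descriptions omit it, and why T has to avoid the two
-- clusters where its halves were and the one where it arrives. Recording the membership of these
-- three clusters with each sum costs a factor 8. All coefficients are rational; they are kept as
-- integers over a common denominator, so that each division becomes a scaling of this denominator.

module Σℕ = SemiringSum ℕₚ.+-*-semiring
module Σℤ = SemiringSum ℤₚ.+-*-semiring

-- Finite sums and finite subsets

module _ {c ℓ} (M : CommutativeMonoid c ℓ) where
  open CommutativeMonoid M renaming (refl to ≈-refl; trans to ≈-trans; sym to ≈-sym)
  open import Algebra.Properties.CommutativeMonoid.Sum M

  sum-≈ε : ∀ {n} {f : Vector Carrier n} → (∀ i → f i ≈ ε) → sum f ≈ ε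
  sum-≈ε {n} f≈ε = ≈-trans (sum-cong-≋ f≈ε) (sum-replicate-zero n)

  sum-only : ∀ {n} (f : Vector Carrier n) p → sum (λ j → if does (p ≟ j) then f j else ε) ≈ f p
  sum-only {suc n} f zero    = ≈-trans (∙-congˡ (sum-≈ε {n} λ _ → ≈-refl)) (identityʳ _)
  sum-only f (suc p) = ≈-trans (identityˡ _) (sum-only (f ∘ suc) p)

  sum-extract : ∀ {n} (f : Vector Carrier n) p →
                sum f ≈ f p ∙ sum (λ j → if does (p ≟ j) then ε else f j)
  sum-extract f p = ≈-trans (sum-cong-≋ (λ j → split (does (p ≟ j))))
    (≈-trans (∑-distrib-+ (λ j → if does (p ≟ j) then f j else ε) _) (∙-congʳ (sum-only f p)))
    where
    split : ∀ b {x} → x ≈ (if b then x else ε) ∙ (if b then ε else x)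
    split true  = ≈-sym (identityʳ _)
    split false = ≈-sym (identityˡ _)

sum-mono-≤ : ∀ {n} {f g : Fin n → ℕ} → (∀ i → f i ≤ g i) → Σℕ.sum f ≤ Σℕ.sum g
sum-mono-≤ {zero}  le = z≤n
sum-mono-≤ {suc n} le = ℕₚ.+-mono-≤ (le zero) (sum-mono-≤ (le ∘ suc))

sum-mono-< : ∀ {n} {f g : Fin n → ℕ} → (∀ i → f i ≤ g i) → ∀ j → f j < g j → Σℕ.sum f < Σℕ.sum g
sum-mono-< le zero    lt = ℕₚ.+-mono-<-≤ lt (sum-mono-≤ (le ∘ suc))
sum-mono-< le (suc j) lt = ℕₚ.+-mono-≤-< (le zero) (sum-mono-< (le ∘ suc) j lt)

sum-const : ∀ n {c} → Σℕ.sum {n} (λ _ → c) ≡ n * c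
sum-const zero    = refl
sum-const (suc n) = cong (λ t → _ + t) (sum-const n)

term≤sum : ∀ {n} (f : Fin n → ℕ) i → f i ≤ Σℕ.sum f
term≤sum f i = ℕₚ.≤-trans (ℕₚ.m≤m+n _ _)
  (ℕₚ.≤-reflexive (sym (sum-extract ℕₚ.+-0-commutativeMonoid f i)))

𝟙 : Bool → ℕ
𝟙 b = if b then 1 else 0

Subset : ℕ → Set
Subset n = Fin n → Bool

# : ∀ {n} → Subset n → ℕ
# S = Σℕ.sum (𝟙 ∘ S)

_∖_ : ∀ {n} → Subset n → Fin n → Subset n
(S ∖ p) j = if does (p ≟ j) then false else S j

#-∖ : ∀ {n} (S : Subset n) {p} → S p ≡ true → # S ≡ suc (# (S ∖ p))
#-∖ S {p} p∈S = trans (sum-extract ℕₚ.+-0-commutativeMonoid (𝟙 ∘ S) p)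
  (cong₂ _+_ (cong 𝟙 p∈S) (Σℕ.sum-cong-≗ (λ j → float (does (p ≟ j)))))
  where
  float : ∀ b {x} → (if b then 0 else 𝟙 x) ≡ 𝟙 (if b then false else x)
  float true  = refl
  float false = refl

#-inhabited : ∀ {n} (S : Subset n) → 0 < # S → ∃[ p ] S p ≡ true
#-inhabited {suc n} S 0<# with S zero in eq
... | true  = zero , eq
... | false with p , p∈S ← #-inhabited (S ∘ suc) 0<# = suc p , p∈S

member-∖ : ∀ {n} (S : Subset n) {p j} → S j ≡ false → (S ∖ p) j ≡ false
member-∖ S {p} {j} eq with does (p ≟ j)
... | true  = refl
... | false = eq

∖-self : ∀ {n} (S : Subset n) p → (S ∖ p) p ≡ false
∖-self S p rewrite dec-true (p ≟ p) refl = refl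

-- Linear dependence over ℤ

record Dependence {n D} (u : Fin n → Fin D → ℤ) (F : Subset n) : Set where
  constructor dep
  field
    coeff    : Fin n → ℤ
    index    : Fin n
    nonzero  : coeff index ≢ 0ℤ
    outside  : ∀ j → F j ≡ false → coeff j ≡ 0ℤ
    relation : ∀ i → Σℤ.sum (λ j → coeff j ℤ.* u j i) ≡ 0ℤ

-- One step of Gaussian elimination without division. Here `a` is the pivot entry, `x` the
-- eliminated row and `z` another row with entry `y` at the pivot: coefficients for the reduced
-- vectors become coefficients for the original ones by scaling with `a` and charging all subtracted
-- multiples to `p`.
eliminate : ∀ (a : ℤ) {n} (c x : Fin n → ℤ) y p →
  let S = Σℤ.sum λ j → c j ℤ.* x j in
  ∀ (z : Fin n → ℤ) → z p ≡ y →
  Σℤ.sum (λ j → (a ℤ.* c j ℤ.- (if does (p ≟ j) then S else 0ℤ)) ℤ.* z j)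
    ≡ Σℤ.sum (λ j → c j ℤ.* (a ℤ.* z j ℤ.- x j ℤ.* y))
eliminate a c x y p z refl = begin
  Σℤ.sum (λ j → (a ℤ.* c j ℤ.- (if does (p ≟ j) then S else 0ℤ)) ℤ.* z j)
    ≡⟨ Σℤ.sum-cong-≗ (λ j → expand (does (p ≟ j)) (c j) (z j)) ⟩
  Σℤ.sum (λ j → a ℤ.* (c j ℤ.* z j) ℤ.+ (if does (p ≟ j) then ℤ.- S ℤ.* z j else 0ℤ))
    ≡⟨ Σℤ.∑-distrib-+ (λ j → a ℤ.* (c j ℤ.* z j)) _ ⟩
  Σℤ.sum (λ j → a ℤ.* (c j ℤ.* z j)) ℤ.+ Σℤ.sum (λ j → if does (p ≟ j) then ℤ.- S ℤ.* z j else 0ℤ)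
    ≡⟨ cong (λ t → Σℤ.sum (λ j → a ℤ.* (c j ℤ.* z j)) ℤ.+ t)
         (trans (sum-only ℤₚ.+-0-commutativeMonoid (λ j → ℤ.- S ℤ.* z j) p) (swap S (z p))) ⟩
  Σℤ.sum (λ j → a ℤ.* (c j ℤ.* z j)) ℤ.+ S ℤ.* (ℤ.- z p)
    ≡⟨ cong (λ t → Σℤ.sum (λ j → a ℤ.* (c j ℤ.* z j)) ℤ.+ t) (Σℤ.*-distribʳ-sum (ℤ.- z p) (λ j → c j ℤ.* x j)) ⟩
  Σℤ.sum (λ j → a ℤ.* (c j ℤ.* z j)) ℤ.+ Σℤ.sum (λ j → c j ℤ.* x j ℤ.* (ℤ.- z p))
    ≡⟨ Σℤ.∑-distrib-+ (λ j → a ℤ.* (c j ℤ.* z j)) _ ⟨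
  Σℤ.sum (λ j → a ℤ.* (c j ℤ.* z j) ℤ.+ c j ℤ.* x j ℤ.* (ℤ.- z p))
    ≡⟨ Σℤ.sum-cong-≗ (λ j → collect a (c j) (z j) (x j) (z p)) ⟩
  Σℤ.sum (λ j → c j ℤ.* (a ℤ.* z j ℤ.- x j ℤ.* z p)) ∎
  where
  open ≡-Reasoning
  S = Σℤ.sum λ j → c j ℤ.* x j
  swap : ∀ s t → ℤ.- s ℤ.* t ≡ s ℤ.* (ℤ.- t)
  swap = ℤ-Solver.solve-∀
  collect : ∀ a c z x y → a ℤ.* (c ℤ.* z) ℤ.+ c ℤ.* x ℤ.* (ℤ.- y) ≡ c ℤ.* (a ℤ.* z ℤ.- x ℤ.* y)
  collect = ℤ-Solver.solve-∀
  expand₁ : ∀ a s c z → (a ℤ.* c ℤ.- s) ℤ.* z ≡ a ℤ.* (c ℤ.* z) ℤ.+ ℤ.- s ℤ.* z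
  expand₁ = ℤ-Solver.solve-∀
  expand₀ : ∀ a c z → (a ℤ.* c ℤ.- 0ℤ) ℤ.* z ≡ a ℤ.* (c ℤ.* z) ℤ.+ 0ℤ
  expand₀ = ℤ-Solver.solve-∀
  expand : ∀ b c z → (a ℤ.* c ℤ.- (if b then S else 0ℤ)) ℤ.* z
                     ≡ a ℤ.* (c ℤ.* z) ℤ.+ (if b then ℤ.- S ℤ.* z else 0ℤ)
  expand true  c z = expand₁ a S c z
  expand false c z = expand₀ a c z

-- Induction on the dimension. If the first coordinate vanishes on `F`, it imposes nothing;
-- otherwise a pivot in `F` clears it, and one dimension and one vector disappear together.
dependence : ∀ D {n} (u : Fin n → Fin D → ℤ) (F : Subset n) → D < # F → Dependence u F
dependence zero {n} u F 0<#F with p , p∈F ← #-inhabited F 0<#F =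
  dep c p c-p c-outside λ ()
  where
  c : Fin n → ℤ
  c j = if does (p ≟ j) then ℤ.1ℤ else 0ℤ
  c-p : c p ≢ 0ℤ
  c-p rewrite dec-true (p ≟ p) refl = λ ()
  c-outside : ∀ j → F j ≡ false → c j ≡ 0ℤ
  c-outside j j∉F with p ≟ j
  ... | yes refl = contradiction (trans (sym p∈F) j∉F) λ ()
  ... | no _     = refl
dependence (suc D) {n} u F D<#F with any? (λ j → (F j Bool.≟ true) ×-dec ¬? (u j zero ℤ.≟ 0ℤ))
... | no none with dep c j c≢0 off rel ← dependence D (λ j i → u j (suc i)) F (ℕₚ.<-trans (ℕₚ.n<1+n D) D<#F) =
  dep c j c≢0 off λ where
    zero    → sum-≈ε ℤₚ.+-0-commutativeMonoid vanish
    (suc i) → rel i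
  where
  vanish : ∀ j → c j ℤ.* u j zero ≡ 0ℤ
  vanish j with F j in j∈F | u j zero ℤ.≟ 0ℤ
  ... | false | _     rewrite off j j∈F = refl
  ... | true  | yes eq rewrite eq = ℤₚ.*-zeroʳ (c j)
  ... | true  | no ne = contradiction (j , j∈F , ne) none
... | yes (p , p∈F , a≢0)
  with dep c′ q c′q≢0 off rel ← dependence D (λ j i → u p zero ℤ.* u j (suc i) ℤ.- u j zero ℤ.* u p (suc i))
         (F ∖ p) (ℕₚ.≤-pred (ℕₚ.≤-trans D<#F (ℕₚ.≤-reflexive (#-∖ F p∈F))))
  = dep c q cq≢0 c-outside c-rel
  where
  a = u p zero
  S = Σℤ.sum λ j → c′ j ℤ.* u j zero
  c : Fin n → ℤ
  c j = a ℤ.* c′ j ℤ.- (if does (p ≟ j) then S else 0ℤ)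
  c-else : ∀ j → p ≢ j → c j ≡ a ℤ.* c′ j
  c-else j p≢j rewrite dec-false (p ≟ j) p≢j = ℤₚ.+-identityʳ _
  -- The reduced dependence vanishes at the pivot, so `q` escapes the correction by `S`, which might
  -- have cancelled its coefficient.
  p≢q : p ≢ q
  p≢q refl = c′q≢0 (off p (∖-self F p))
  cq≢0 : c q ≢ 0ℤ
  cq≢0 eq with ℤₚ.i*j≡0⇒i≡0∨j≡0 a (trans (sym (c-else q p≢q)) eq)
  ... | inj₁ a≡0  = a≢0 a≡0
  ... | inj₂ c≡0 = c′q≢0 c≡0
  c-outside : ∀ j → F j ≡ false → c j ≡ 0ℤ
  c-outside j j∉F = trans (c-else j λ { refl → contradiction (trans (sym p∈F) j∉F) λ () })
    (trans (cong (a ℤ.*_) (off j (member-∖ F {p} {j} j∉F))) (ℤₚ.*-zeroʳ a))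
  c-rel : ∀ i → Σℤ.sum (λ j → c j ℤ.* u j i) ≡ 0ℤ
  c-rel zero = trans (eliminate a c′ (λ j → u j zero) a p (λ j → u j zero) refl)
    (sum-≈ε ℤₚ.+-0-commutativeMonoid (λ j → cancel (c′ j) a (u j zero)))
    where
    cancel : ∀ c a x → c ℤ.* (a ℤ.* x ℤ.- x ℤ.* a) ≡ 0ℤ
    cancel = ℤ-Solver.solve-∀
  c-rel (suc i) = trans (eliminate a c′ (λ j → u j zero) _ p (λ j → u j (suc i)) refl) (rel i)

-- The Steinitz chain

𝟙≤1 : ∀ b → 𝟙 b ≤ 1
𝟙≤1 true  = ℕₚ.≤-refl
𝟙≤1 false = z≤n

𝟙-mono : ∀ {a b} → (b ≡ false → a ≡ false) → 𝟙 a ≤ 𝟙 b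
𝟙-mono {a} {true}  _ = 𝟙≤1 a
𝟙-mono {a} {false} f rewrite f refl = z≤n

does-false : ∀ {p} {P : Set p} (P? : Dec P) → does P? ≡ false → ¬ P
does-false (no ¬p) _ = ¬p

does-true : ∀ {p} {P : Set p} (P? : Dec P) → does P? ≡ true → P
does-true (yes p) _ = p

-- The ratio test of the simplex method: `x h / a h` is minimal among the indices with `a h > 0`. In
-- the cross-multiplied form the indices with `a h ≡ 0` satisfy `least` trivially.
record LeastRatio {N} (x a : Fin N → ℕ) : Set where
  constructor leastAt
  field
    index    : Fin N
    positive : 0 < a index
    least    : ∀ h → x index * a h ≤ x h * a index

leastRatio : ∀ {N} (x a : Fin N → ℕ) i → 0 < a i → LeastRatio x a
leastRatio {suc N} x a i 0<aᵢ with any? (λ j → 0 ℕ.<? a (suc j))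
... | no none = leastAt zero (first i 0<aᵢ) all-zero
  where
  first : ∀ i → 0 < a i → 0 < a zero
  first zero    0<a = 0<a
  first (suc j) 0<a = contradiction (j , 0<a) none
  all-zero : ∀ h → x zero * a h ≤ x h * a zero
  all-zero zero    = ℕₚ.≤-refl
  all-zero (suc h) = ℕₚ.≤-trans
    (ℕₚ.≤-reflexive (trans (cong (x zero *_) (ℕₚ.n≤0⇒n≡0 (ℕₚ.≮⇒≥ λ 0<a → none (h , 0<a)))) (ℕₚ.*-zeroʳ (x zero))))
    z≤n
... | yes (i′ , 0<aᵢ′) with leastRatio (x ∘ suc) (a ∘ suc) i′ 0<aᵢ′
... | leastAt j 0<aⱼ leastⱼ with x (suc j) * a zero ℕ.≤? x zero * a (suc j)
...   | yes le = leastAt (suc j) 0<aⱼ λ where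
  zero    → le
  (suc h) → leastⱼ h
...   | no gt = leastAt zero 0<a₀ least₀
  where
  open ℕₚ.≤-Reasoning
  lt : x zero * a (suc j) < x (suc j) * a zero
  lt = ℕₚ.≰⇒> gt
  rotate : ∀ x y z → x * y * z ≡ x * z * y
  rotate = ℕ-Solver.solve-∀
  0<a₀ : 0 < a zero
  0<a₀ = ℕₚ.n≢0⇒n>0 λ a₀≡0 →
    ℕₚ.n≮0 (subst (x zero * a (suc j) <_) (trans (cong (x (suc j) *_) a₀≡0) (ℕₚ.*-zeroʳ (x (suc j)))) lt)
  least₀ : ∀ h → x zero * a h ≤ x h * a zero
  least₀ zero    = ℕₚ.≤-refl
  least₀ (suc h) = ℕₚ.*-cancelʳ-≤ _ _ (a (suc j)) {{ℕ.>-nonZero 0<aⱼ}} (begin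
    x zero * a (suc h) * a (suc j)    ≡⟨ rotate (x zero) (a (suc h)) (a (suc j)) ⟩
    x zero * a (suc j) * a (suc h)    ≤⟨ ℕₚ.*-monoˡ-≤ (a (suc h)) (ℕₚ.<⇒≤ lt) ⟩
    x (suc j) * a zero * a (suc h)    ≡⟨ rotate (x (suc j)) (a zero) (a (suc h)) ⟩
    x (suc j) * a (suc h) * a zero    ≤⟨ ℕₚ.*-monoˡ-≤ (a zero) (leastⱼ h) ⟩
    x (suc h) * a (suc j) * a zero    ≡⟨ rotate (x (suc h)) (a (suc j)) (a zero) ⟩
    x (suc h) * a zero * a (suc j)    ∎)

_⁺ _⁻ : ℤ → ℕ
(+ n) ⁺    = n
-[1+ n ] ⁺ = 0
(+ n) ⁻    = 0
-[1+ n ] ⁻ = suc n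

⁺-⁻ : ∀ x → x ≡ + (x ⁺) ℤ.- + (x ⁻)
⁺-⁻ (+ n)    = sym (ℤₚ.+-identityʳ (+ n))
⁺-⁻ -[1+ n ] = refl

⁺+⁻≡∣∣ : ∀ x → x ⁺ + x ⁻ ≡ ℤ.∣ x ∣
⁺+⁻≡∣∣ (+ n)    = ℕₚ.+-identityʳ n
⁺+⁻≡∣∣ -[1+ n ] = refl

subsetSum : ∀ {n d} → (Fin n → Fin d → ℤ) → Subset n → Fin d → ℤ
subsetSum v S i = Σℤ.sum λ j → + 𝟙 (S j) ℤ.* v j i

fractional? : ∀ q m → Dec (m ≢ 0 × m ≢ q)
fractional? q m = ¬? (m ℕ.≟ 0) ×-dec ¬? (m ℕ.≟ q)

fractional : ∀ {n} → ℕ → (Fin n → ℕ) → Subset n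
fractional q m j = does (fractional? q (m j))

-- The weights of the Grinberg–Sevastyanov proof of the Steinitz lemma are
-- 1 − m j / q; storing their complements m keeps everything in ℕ.
record Weighting {n d} (v : Fin n → Fin d → ℤ) (S : Subset n) (t : ℕ) : Set where
  field
    q       : ℕ
    m       : Fin n → ℕ
    q>0     : 0 < q
    m≤q     : ∀ j → m j ≤ q
    outside : ∀ j → S j ≡ false → m j ≡ 0
    total   : Σℕ.sum m ≡ t * q
    balance : ∀ i → Σℤ.sum (λ j → + m j ℤ.* v j i) ≡ + q ℤ.* subsetSum v S i

  #fractional : ℕ
  #fractional = # (fractional q m)

⁻>0⇒⁺≡0 : ∀ x → 0 < x ⁻ → x ⁺ ≡ 0
⁻>0⇒⁺≡0 -[1+ n ] _ = refl

⁺>0⇒⁻≡0 : ∀ x → 0 < x ⁺ → x ⁻ ≡ 0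
⁺>0⇒⁻≡0 (+ n) _ = refl

float-ℕ : ∀ b x y → + (if b then 0 else x) ℤ.* y ≡ (if b then 0ℤ else + x ℤ.* y)
float-ℕ true  x y = ℤₚ.*-zeroˡ y
float-ℕ false x y = refl

subsetSum-∖ : ∀ {n d} (v : Fin n → Fin d → ℤ) (S : Subset n) {p} → S p ≡ true → ∀ i →
              subsetSum v S i ≡ v p i ℤ.+ subsetSum v (S ∖ p) i
subsetSum-∖ v S {p} p∈S i = trans (sum-extract ℤₚ.+-0-commutativeMonoid (λ j → + 𝟙 (S j) ℤ.* v j i) p)
  (cong₂ ℤ._+_ (trans (cong (λ b → + 𝟙 b ℤ.* v p i) p∈S) (ℤₚ.*-identityˡ (v p i)))
    (Σℤ.sum-cong-≗ (λ j → float (does (p ≟ j)) (S j) (v j i))))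
  where
  float : ∀ b x y → (if b then 0ℤ else + 𝟙 x ℤ.* y) ≡ + 𝟙 (if b then false else x) ℤ.* y
  float true  x y = sym (ℤₚ.*-zeroˡ y)
  float false x y = refl

ℤ-linear : ∀ {n} a b (x y z : Fin n → ℤ) →
  Σℤ.sum (λ j → (a ℤ.* x j ℤ.+ b ℤ.* y j) ℤ.* z j)
    ≡ a ℤ.* Σℤ.sum (λ j → x j ℤ.* z j) ℤ.+ b ℤ.* Σℤ.sum (λ j → y j ℤ.* z j)
ℤ-linear a b x y z = begin
  Σℤ.sum (λ j → (a ℤ.* x j ℤ.+ b ℤ.* y j) ℤ.* z j)
    ≡⟨ Σℤ.sum-cong-≗ (λ j → expand a b (x j) (y j) (z j)) ⟩
  Σℤ.sum (λ j → a ℤ.* (x j ℤ.* z j) ℤ.+ b ℤ.* (y j ℤ.* z j))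
    ≡⟨ Σℤ.∑-distrib-+ (λ j → a ℤ.* (x j ℤ.* z j)) _ ⟩
  Σℤ.sum (λ j → a ℤ.* (x j ℤ.* z j)) ℤ.+ Σℤ.sum (λ j → b ℤ.* (y j ℤ.* z j))
    ≡⟨ cong₂ ℤ._+_ (Σℤ.*-distribˡ-sum a (λ j → x j ℤ.* z j)) (Σℤ.*-distribˡ-sum b (λ j → y j ℤ.* z j)) ⟨
  a ℤ.* Σℤ.sum (λ j → x j ℤ.* z j) ℤ.+ b ℤ.* Σℤ.sum (λ j → y j ℤ.* z j) ∎
  where
  open ≡-Reasoning
  expand : ∀ a b x y z → (a ℤ.* x ℤ.+ b ℤ.* y) ℤ.* z ≡ a ℤ.* (x ℤ.* z) ℤ.+ b ℤ.* (y ℤ.* z)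
  expand = ℤ-Solver.solve-∀

ℕ-linear : ∀ {n} a b (x y : Fin n → ℕ) →
  Σℕ.sum (λ j → a * x j + b * y j) ≡ a * Σℕ.sum x + b * Σℕ.sum y
ℕ-linear a b x y = trans (Σℕ.∑-distrib-+ (λ j → a * x j) _)
  (sym (cong₂ _+_ (Σℕ.*-distribˡ-sum a x) (Σℕ.*-distribˡ-sum b y)))

pos-linear : ∀ a x b y → + (a * x + b * y) ≡ + a ℤ.* + x ℤ.+ + b ℤ.* + y
pos-linear a x b y = cong₂ ℤ._+_ (ℤₚ.pos-* a x) (ℤₚ.pos-* b y)

-- All weights 1 - m / q on `S` are multiplied by s / (s + 1). Their total falls from s + 1 to s,
-- the value required once an element of weight zero has been dropped.
rescale : ∀ {n d t s} {v : Fin n → Fin d → ℤ} {S} → # S ≡ t + suc s → Weighting v S t → Weighting v S (suc t)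
rescale {n} {d} {t} {s} {v} {S} #S w = record
  { q = q * suc s ; m = m′
  ; q>0 = ℕₚ.*-mono-≤ q>0 (s≤s z≤n)
  ; m≤q = λ j → bound (S j) (m≤q j)
  ; outside = λ j j∉S → trans (cong₂ (λ b x → q * 𝟙 b + s * x) j∉S (outside j j∉S))
                          (cong₂ _+_ (ℕₚ.*-zeroʳ q) (ℕₚ.*-zeroʳ s))
  ; total = trans (ℕ-linear q s (𝟙 ∘ S) m) (trans (cong₂ (λ x y → q * x + s * y) #S total) (arith q s t))
  ; balance = λ i → begin
      Σℤ.sum (λ j → + m′ j ℤ.* v j i)
        ≡⟨ Σℤ.sum-cong-≗ (λ j → cong (ℤ._* v j i) (pos-linear q (𝟙 (S j)) s (m j))) ⟩
      Σℤ.sum (λ j → (+ q ℤ.* + 𝟙 (S j) ℤ.+ + s ℤ.* + m j) ℤ.* v j i)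
        ≡⟨ ℤ-linear (+ q) (+ s) (λ j → + 𝟙 (S j)) (λ j → + m j) (λ j → v j i) ⟩
      + q ℤ.* subsetSum v S i ℤ.+ + s ℤ.* Σℤ.sum (λ j → + m j ℤ.* v j i)
        ≡⟨ cong (λ x → + q ℤ.* subsetSum v S i ℤ.+ + s ℤ.* x) (balance i) ⟩
      + q ℤ.* subsetSum v S i ℤ.+ + s ℤ.* (+ q ℤ.* subsetSum v S i)
        ≡⟨ collect (+ q) (+ s) (subsetSum v S i) ⟩
      + q ℤ.* (ℤ.1ℤ ℤ.+ + s) ℤ.* subsetSum v S i
        ≡⟨ cong (ℤ._* subsetSum v S i) (ℤₚ.pos-* q (suc s)) ⟨
      + (q * suc s) ℤ.* subsetSum v S i ∎
  }
  where
  open Weighting w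
  open ≡-Reasoning
  m′ : Fin n → ℕ
  m′ j = q * 𝟙 (S j) + s * m j
  collect : ∀ q s x → q ℤ.* x ℤ.+ s ℤ.* (q ℤ.* x) ≡ q ℤ.* (ℤ.1ℤ ℤ.+ s) ℤ.* x
  collect = ℤ-Solver.solve-∀
  arith : ∀ q s t → q * (t + suc s) + s * (t * q) ≡ suc t * (q * suc s)
  arith = ℕ-Solver.solve-∀
  bound : ∀ b {x} → x ≤ q → q * 𝟙 b + s * x ≤ q * suc s
  bound b {x} x≤q = ℕₚ.≤-trans (ℕₚ.+-mono-≤ (ℕₚ.*-monoʳ-≤ q (𝟙≤1 b)) (ℕₚ.*-monoʳ-≤ s x≤q))
    (ℕₚ.≤-reflexive (fact q s))
    where
    fact : ∀ q s → q * 1 + s * q ≡ q * suc s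
    fact = ℕ-Solver.solve-∀

-- The row of ones makes moves along a dependence preserve the total weight.
withOnes : ∀ {n d} → (Fin n → Fin d → ℤ) → Fin n → Fin (suc d) → ℤ
withOnes v j zero    = ℤ.1ℤ
withOnes v j (suc i) = v j i

-- A dependence among the fractional entries is a direction in which the weights can move while all
-- equations persist. The move goes as far as the bounds 0 and q allow, so some fractional entry
-- reaches a bound: a step towards a vertex of the polytope of weightings.
module Move {n d t : ℕ} {v : Fin n → Fin d → ℤ} {S : Subset n} (w : Weighting v S t)
            (D : Dependence (withOnes v) (fractional (Weighting.q w) (Weighting.m w))) where
  open Weighting w
  open Dependence D renaming (coeff to c; index to j₀)

  -- The first `n` entries stand for the lower bounds, approached at speed `c j ⁻`, and the last `n`
  -- for the upper bounds, approached at speed `c j ⁺`.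
  slack speed : Fin (n + n) → ℕ
  slack = [ m , (λ j → q ∸ m j) ] ∘ splitAt n
  speed = [ _⁻ ∘ c , _⁺ ∘ c ] ∘ splitAt n

  ratio : LeastRatio slack speed
  ratio with c j₀ in eq
  ... | + zero    = contradiction eq nonzero
  ... | + suc x   = leastRatio slack speed (n ↑ʳ j₀)
                      (subst (0 <_) (sym (trans (cong [ _⁻ ∘ c , _⁺ ∘ c ] (splitAt-↑ʳ n n j₀)) (cong _⁺ eq))) (s≤s z≤n))
  ... | -[1+ x ] = leastRatio slack speed (j₀ ↑ˡ n)
                      (subst (0 <_) (sym (trans (cong [ _⁻ ∘ c , _⁺ ∘ c ] (splitAt-↑ˡ n j₀ n)) (cong _⁻ eq))) (s≤s z≤n))

  open LeastRatio ratio renaming (index to h₀)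
  r p : ℕ
  r = slack h₀
  p = speed h₀

  down-room : ∀ j → r * (c j ⁻) ≤ p * m j
  down-room j = subst₂ _≤_ (cong (λ z → r * [ _⁻ ∘ c , _⁺ ∘ c ] z) (splitAt-↑ˡ n j n))
    (trans (cong (λ z → [ m , (λ j → q ∸ m j) ] z * p) (splitAt-↑ˡ n j n)) (ℕₚ.*-comm (m j) p)) (least (j ↑ˡ n))

  up-room : ∀ j → r * (c j ⁺) ≤ p * (q ∸ m j)
  up-room j = subst₂ _≤_ (cong (λ z → r * [ _⁻ ∘ c , _⁺ ∘ c ] z) (splitAt-↑ʳ n n j))
    (trans (cong (λ z → [ m , (λ j → q ∸ m j) ] z * p) (splitAt-↑ʳ n n j)) (ℕₚ.*-comm (q ∸ m j) p)) (least (n ↑ʳ j))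

  -- This is p · (m + (r / p) · c), over the new denominator p · q; the truncated subtraction is
  -- exact by `down-room`.
  m′ : Fin n → ℕ
  m′ j = (p * m j ∸ r * (c j ⁻)) + r * (c j ⁺)

  fill : ∀ j → p * m j + p * (q ∸ m j) ≡ p * q
  fill j = trans (sym (ℕₚ.*-distribˡ-+ p (m j) _)) (cong (p *_) (ℕₚ.m+[n∸m]≡n (m≤q j)))

  m′≤ : ∀ j → m′ j ≤ p * q
  m′≤ j = ℕₚ.≤-trans (ℕₚ.+-mono-≤ (ℕₚ.m∸n≤m (p * m j) (r * (c j ⁻))) (up-room j)) (ℕₚ.≤-reflexive (fill j))

  +m′ : ∀ j → + m′ j ≡ + p ℤ.* + m j ℤ.+ + r ℤ.* c j
  +m′ j = begin
    + (p * m j ∸ r * (c j ⁻)) ℤ.+ + (r * (c j ⁺))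
      ≡⟨ cong (ℤ._+ + (r * (c j ⁺))) (trans (sym (ℤₚ.⊖-≥ (down-room j))) (sym (ℤₚ.m-n≡m⊖n (p * m j) (r * (c j ⁻))))) ⟩
    + (p * m j) ℤ.- + (r * (c j ⁻)) ℤ.+ + (r * (c j ⁺))
      ≡⟨ cong₂ ℤ._+_ (cong₂ ℤ._-_ (ℤₚ.pos-* p (m j)) (ℤₚ.pos-* r _)) (ℤₚ.pos-* r _) ⟩
    + p ℤ.* + m j ℤ.- + r ℤ.* + (c j ⁻) ℤ.+ + r ℤ.* + (c j ⁺)
      ≡⟨ collect (+ p ℤ.* + m j) (+ r) (+ (c j ⁻)) (+ (c j ⁺)) ⟩
    + p ℤ.* + m j ℤ.+ + r ℤ.* (+ (c j ⁺) ℤ.- + (c j ⁻))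
      ≡⟨ cong (λ x → + p ℤ.* + m j ℤ.+ + r ℤ.* x) (⁺-⁻ (c j)) ⟨
    + p ℤ.* + m j ℤ.+ + r ℤ.* c j ∎
    where
    open ≡-Reasoning
    collect : ∀ a r x y → a ℤ.- r ℤ.* x ℤ.+ r ℤ.* y ≡ a ℤ.+ r ℤ.* (y ℤ.- x)
    collect = ℤ-Solver.solve-∀

  m′-fixed : ∀ j → c j ≡ 0ℤ → m′ j ≡ p * m j
  m′-fixed j eq rewrite eq | ℕₚ.*-zeroʳ r = ℕₚ.+-identityʳ _

  kernel : ∀ (x : Fin n → ℤ) → Σℤ.sum (λ j → c j ℤ.* x j) ≡ 0ℤ →
           Σℤ.sum (λ j → + m′ j ℤ.* x j) ≡ + p ℤ.* Σℤ.sum (λ j → + m j ℤ.* x j)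
  kernel x rel = begin
    Σℤ.sum (λ j → + m′ j ℤ.* x j)
      ≡⟨ Σℤ.sum-cong-≗ (λ j → cong (ℤ._* x j) (+m′ j)) ⟩
    Σℤ.sum (λ j → (+ p ℤ.* + m j ℤ.+ + r ℤ.* c j) ℤ.* x j)
      ≡⟨ ℤ-linear (+ p) (+ r) (λ j → + m j) c x ⟩
    + p ℤ.* Σℤ.sum (λ j → + m j ℤ.* x j) ℤ.+ + r ℤ.* Σℤ.sum (λ j → c j ℤ.* x j)
      ≡⟨ cong (λ z → + p ℤ.* Σℤ.sum (λ j → + m j ℤ.* x j) ℤ.+ + r ℤ.* z) rel ⟩
    + p ℤ.* Σℤ.sum (λ j → + m j ℤ.* x j) ℤ.+ + r ℤ.* 0ℤ
      ≡⟨ trans (cong (λ z → + p ℤ.* Σℤ.sum (λ j → + m j ℤ.* x j) ℤ.+ z) (ℤₚ.*-zeroʳ (+ r))) (ℤₚ.+-identityʳ _) ⟩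
    + p ℤ.* Σℤ.sum (λ j → + m j ℤ.* x j) ∎
    where open ≡-Reasoning

  sum-pos : ∀ {n} (f : Fin n → ℕ) → + Σℕ.sum f ≡ Σℤ.sum (λ j → + f j ℤ.* ℤ.1ℤ)
  sum-pos {zero}  f = refl
  sum-pos {suc n} f = cong₂ ℤ._+_ (sym (ℤₚ.*-identityʳ (+ f zero))) (sum-pos (f ∘ suc))

  moved : Weighting v S t
  moved = record
    { q = p * q ; m = m′
    ; q>0 = ℕₚ.*-mono-≤ positive q>0
    ; m≤q = m′≤
    ; outside = λ j j∉S → trans
        (m′-fixed j (Dependence.outside D j (zero-not-fractional j (Weighting.outside w j j∉S))))
        (trans (cong (p *_) (Weighting.outside w j j∉S)) (ℕₚ.*-zeroʳ p))
    ; total = ℤₚ.+-injective (begin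
        + Σℕ.sum m′                       ≡⟨ sum-pos m′ ⟩
        Σℤ.sum (λ j → + m′ j ℤ.* ℤ.1ℤ)    ≡⟨ kernel (λ _ → ℤ.1ℤ) (relation zero) ⟩
        + p ℤ.* Σℤ.sum (λ j → + m j ℤ.* ℤ.1ℤ) ≡⟨ cong (+ p ℤ.*_) (sum-pos m) ⟨
        + p ℤ.* + Σℕ.sum m                ≡⟨ ℤₚ.pos-* p _ ⟨
        + (p * Σℕ.sum m)                  ≡⟨ cong (λ x → + (p * x)) total ⟩
        + (p * (t * q))                   ≡⟨ cong +_ (arith p t q) ⟩
        + (t * (p * q))                   ∎)
    ; balance = λ i → begin
        Σℤ.sum (λ j → + m′ j ℤ.* v j i)       ≡⟨ kernel (λ j → v j i) (relation (suc i)) ⟩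
        + p ℤ.* Σℤ.sum (λ j → + m j ℤ.* v j i) ≡⟨ cong (+ p ℤ.*_) (balance i) ⟩
        + p ℤ.* (+ q ℤ.* subsetSum v S i)     ≡⟨ ℤₚ.*-assoc (+ p) (+ q) _ ⟨
        + p ℤ.* + q ℤ.* subsetSum v S i       ≡⟨ cong (ℤ._* subsetSum v S i) (ℤₚ.pos-* p q) ⟨
        + (p * q) ℤ.* subsetSum v S i         ∎
    }
    where
    open ≡-Reasoning
    arith : ∀ p t q → p * (t * q) ≡ t * (p * q)
    arith = ℕ-Solver.solve-∀
    zero-not-fractional : ∀ j → m j ≡ 0 → fractional q m j ≡ false
    zero-not-fractional j mⱼ≡0 = dec-false (fractional? q (m j)) λ (m≢0 , _) → m≢0 mⱼ≡0

  integral-moved : ∀ j → ¬ (m j ≢ 0 × m j ≢ q) → ¬ (m′ j ≢ 0 × m′ j ≢ p * q)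
  integral-moved j integral (m′≢0 , m′≢pq) = integral
    ( (λ m≡0 → m′≢0 (trans fixed (trans (cong (p *_) m≡0) (ℕₚ.*-zeroʳ p))))
    , (λ m≡q → m′≢pq (trans fixed (cong (p *_) m≡q))))
    where fixed = m′-fixed j (Dependence.outside D j (dec-false (fractional? q (m j)) integral))

  tight : ∃[ j ] c j ≢ 0ℤ × ¬ (m′ j ≢ 0 × m′ j ≢ p * q)
  tight = at (splitAt n h₀) refl
   where
   at : ∀ z → splitAt n h₀ ≡ z → ∃[ j ] c j ≢ 0ℤ × ¬ (m′ j ≢ 0 × m′ j ≢ p * q)
   at (inj₁ j) eq = j , c≢0 , λ (m′≢0 , _) → m′≢0 m′≡0
    where
    p≡ : p ≡ c j ⁻
    p≡ = cong [ _⁻ ∘ c , _⁺ ∘ c ] eq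
    r≡ : r ≡ m j
    r≡ = cong [ m , (λ j → q ∸ m j) ] eq
    c≢0 : c j ≢ 0ℤ
    c≢0 cⱼ≡0 = ℕₚ.<-irrefl (sym (trans p≡ (cong _⁻ cⱼ≡0))) positive
    m′≡0 : m′ j ≡ 0
    m′≡0 = cong₂ _+_
      (trans (cong₂ (λ x y → p * x ∸ r * y) (sym r≡) (sym p≡)) (trans (cong (p * r ∸_) (ℕₚ.*-comm r p)) (ℕₚ.n∸n≡0 (p * r))))
      (trans (cong (r *_) (⁻>0⇒⁺≡0 (c j) (subst (0 <_) p≡ positive))) (ℕₚ.*-zeroʳ r))
   at (inj₂ j) eq = j , c≢0 , λ (_ , m′≢pq) → m′≢pq m′≡pq
    where
    p≡ : p ≡ c j ⁺
    p≡ = cong [ _⁻ ∘ c , _⁺ ∘ c ] eq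
    r≡ : r ≡ q ∸ m j
    r≡ = cong [ m , (λ j → q ∸ m j) ] eq
    c≢0 : c j ≢ 0ℤ
    c≢0 cⱼ≡0 = ℕₚ.<-irrefl (sym (trans p≡ (cong _⁺ cⱼ≡0))) positive
    m′≡pq : m′ j ≡ p * q
    m′≡pq = trans (cong₂ (λ x y → (p * m j ∸ r * x) + r * y) (⁺>0⇒⁻≡0 (c j) (subst (0 <_) p≡ positive)) (sym p≡))
      (trans (cong₂ _+_ (cong (p * m j ∸_) (ℕₚ.*-zeroʳ r)) (trans (ℕₚ.*-comm r p) (cong (p *_) r≡))) (fill j))

  fewer : # (fractional (p * q) m′) < #fractional
  fewer with j , c≢0 , integral ← tight = sum-mono-< shrink j (subst₂ _<_ (sym (cong 𝟙 j∉)) (sym (cong 𝟙 j∈)) (s≤s z≤n))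
    where
    j∉ : fractional (p * q) m′ j ≡ false
    j∉ = dec-false (fractional? (p * q) (m′ j)) integral
    j∈ : fractional q m j ≡ true
    j∈ with fractional q m j in eq
    ... | true  = refl
    ... | false = contradiction (Dependence.outside D j eq) c≢0
    shrink : ∀ j → 𝟙 (fractional (p * q) m′ j) ≤ 𝟙 (fractional q m j)
    shrink j = 𝟙-mono λ eq → dec-false (fractional? (p * q) (m′ j))
      (integral-moved j (does-false (fractional? q (m j)) eq))

-- A vertex of a polytope in a box, cut out by d + 1 equations, has at most d + 1 entries strictly
-- between their bounds. Each move removes at least one such entry, and the fuel bounds their
-- number.
settle : ∀ fuel {n d t} {v : Fin n → Fin d → ℤ} {S} (w : Weighting v S t) → Weighting.#fractional w ≤ fuel →
         ∃[ w′ ] Weighting.#fractional {v = v} {S = S} {t = t} w′ ≤ suc d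
settle fuel {d = d} {v = v} w ≤fuel with Weighting.#fractional w ℕ.≤? suc d
... | yes small = w , small
... | no large with dependence (suc d) (withOnes v) (fractional (Weighting.q w) (Weighting.m w)) (ℕₚ.≰⇒> large)
settle zero       w ≤fuel | no large | D = contradiction (ℕₚ.≤-trans ≤fuel z≤n) large
settle (suc fuel) w ≤fuel | no large | D =
  settle fuel (Move.moved w D) (ℕₚ.≤-pred (ℕₚ.≤-trans (Move.fewer w D) ≤fuel))

discard : ∀ {n d} {v : Fin n → Fin d → ℤ} {S} (w : Weighting v S (suc d)) → Weighting.#fractional w ≤ suc d →
          ∃[ p ] S p ≡ true × Weighting v (S ∖ p) d
discard {n} {d} {v} {S} w few with any? (λ j → Weighting.m w j ℕ.≟ Weighting.q w)
... | no none = contradiction total (ℕₚ.<⇒≢ (begin-strict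
      Σℕ.sum m                                     ≤⟨ sum-mono-≤ bound ⟩
      Σℕ.sum (λ j → ℕ.pred q * 𝟙 (fractional q m j)) ≡⟨ Σℕ.*-distribˡ-sum (ℕ.pred q) (𝟙 ∘ fractional q m) ⟨
      ℕ.pred q * #fractional                       ≤⟨ ℕₚ.*-monoʳ-≤ (ℕ.pred q) few ⟩
      ℕ.pred q * suc d                             <⟨ ℕₚ.*-monoˡ-< (suc d) (ℕₚ.≤-reflexive (ℕₚ.suc-pred q {{ℕ.>-nonZero q>0}})) ⟩
      q * suc d                                    ≡⟨ ℕₚ.*-comm q (suc d) ⟩
      suc d * q                                    ∎))
  where
  open Weighting w
  open ℕₚ.≤-Reasoning
  bound : ∀ j → m j ≤ ℕ.pred q * 𝟙 (fractional q m j)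
  bound j with m j ℕ.≟ 0 | m j ℕ.≟ q
  ... | yes eq | _      = ℕₚ.≤-trans (ℕₚ.≤-reflexive eq) z≤n
  ... | no _   | yes eq = contradiction (j , eq) none
  ... | no ≢0  | no ≢q  = ℕₚ.≤-trans (ℕₚ.<⇒≤pred (ℕₚ.≤∧≢⇒< (m≤q j) ≢q)) (ℕₚ.≤-reflexive (sym
    (trans (cong (λ b → ℕ.pred q * 𝟙 b) (dec-true (fractional? q (m j)) (≢0 , ≢q))) (ℕₚ.*-identityʳ (ℕ.pred q)))))
... | yes (p , mₚ≡q) = p , p∈S , record
  { q = q ; m = m′ ; q>0 = q>0
  ; m≤q = λ j → bound (does (p ≟ j)) (m≤q j)
  ; outside = outside′
  ; total = ℕₚ.+-cancelˡ-≡ q _ _ (trans (cong (_+ Σℕ.sum m′) (sym mₚ≡q)) (trans (sym (sum-extract ℕₚ.+-0-commutativeMonoid m p)) total))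
  ; balance = λ i → ∙-cancelˡ (+ q ℤ.* v p i) _ _ (begin
      + q ℤ.* v p i ℤ.+ Σℤ.sum (λ j → + m′ j ℤ.* v j i)
        ≡⟨ cong₂ ℤ._+_ (cong (λ x → + x ℤ.* v p i) (sym mₚ≡q)) (Σℤ.sum-cong-≗ (λ j → float-ℕ (does (p ≟ j)) (m j) (v j i))) ⟩
      + m p ℤ.* v p i ℤ.+ Σℤ.sum (λ j → if does (p ≟ j) then 0ℤ else + m j ℤ.* v j i)
        ≡⟨ sum-extract ℤₚ.+-0-commutativeMonoid (λ j → + m j ℤ.* v j i) p ⟨
      Σℤ.sum (λ j → + m j ℤ.* v j i)
        ≡⟨ balance i ⟩
      + q ℤ.* subsetSum v S i
        ≡⟨ cong (+ q ℤ.*_) (subsetSum-∖ v S p∈S i) ⟩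
      + q ℤ.* (v p i ℤ.+ subsetSum v (S ∖ p) i)
        ≡⟨ ℤₚ.*-distribˡ-+ (+ q) (v p i) _ ⟩
      + q ℤ.* v p i ℤ.+ + q ℤ.* subsetSum v (S ∖ p) i ∎)
  }
  where
  open Weighting w
  open ≡-Reasoning
  open import Algebra.Properties.Group (AbelianGroup.group ℤₚ.+-0-abelianGroup) using (∙-cancelˡ)
  p∈S : S p ≡ true
  p∈S with S p in eq
  ... | true  = refl
  ... | false = contradiction (trans (sym (outside p eq)) mₚ≡q) (ℕₚ.<⇒≢ q>0)
  m′ : Fin n → ℕ
  m′ j = if does (p ≟ j) then 0 else m j
  bound : ∀ b {x} → x ≤ q → (if b then 0 else x) ≤ q
  bound true  _   = z≤n
  bound false x≤q = x≤q
  outside′ : ∀ j → (S ∖ p) j ≡ false → m′ j ≡ 0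
  outside′ j with does (p ≟ j)
  ... | true  = λ _ → refl
  ... | false = outside j

step : ∀ {n d s} {v : Fin n → Fin d → ℤ} {S} → # S ≡ d + suc s → Weighting v S d →
       ∃[ p ] S p ≡ true × Weighting v (S ∖ p) d
step #S w with w′ , few ← settle _ (rescale #S w) ℕₚ.≤-refl = discard w′ few

-- Counting lattice points

-- Coordinates are weighted d, d − 1, …, 1, so that tails are weighted alike.
weight : ∀ {d} → Fin d → ℕ
weight {suc d} zero    = suc d
weight {suc d} (suc i) = weight i

totalWeight : ∀ {d} → (Fin d → ℕ) → ℕ
totalWeight x = Σℕ.sum λ i → weight i * x i

incrementHead : ∀ {d} → Vec ℕ (suc d) → Vec ℕ (suc d)
incrementHead (x ∷ xs) = suc x ∷ xs

-- Vectors of total weight at most t, by the recursion "the head is zero or can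
-- be decremented"; complete as soon as t ≤ fuel.
lightVectors : ∀ d (t fuel : ℕ) → List (Vec ℕ d)
lightVectors⁺ : ∀ d (t fuel : ℕ) → List (Vec ℕ d)

lightVectors zero    t fuel = [] ∷ []
lightVectors (suc d) t fuel = List.map (0 ∷_) (lightVectors d t t) ++ lightVectors⁺ (suc d) t fuel

lightVectors⁺ zero    t fuel       = []
lightVectors⁺ (suc d) t zero       = []
lightVectors⁺ (suc d) t (suc fuel) =
  if does (suc d ℕ.≤? t) then List.map incrementHead (lightVectors (suc d) (t ∸ suc d) fuel) else []

lightVectors-complete : ∀ {d t fuel} (x : Fin d → ℕ) → totalWeight x ≤ t → t ≤ fuel →
                        tabulate x ∈ lightVectors d t fuel
lightVectors-complete {zero}  x ≤t t≤ = here refl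
lightVectors-complete {suc d} x = go (x zero) _
  where
  rest = totalWeight (x ∘ suc)
  go : ∀ x₀ fuel {t} → suc d * x₀ + rest ≤ t → t ≤ fuel →
       (x₀ ∷ tabulate (x ∘ suc)) ∈ lightVectors (suc d) t fuel
  go zero fuel ≤t t≤ = ∈-++⁺ˡ (∈-map⁺ (0 ∷_) (lightVectors-complete (x ∘ suc)
    (ℕₚ.≤-trans (ℕₚ.m≤n+m rest (suc d * 0)) ≤t) ℕₚ.≤-refl))
  go (suc x₀) zero ≤t t≤ = contradiction (ℕₚ.≤-trans ≤t t≤) λ ()
  go (suc x₀) (suc fuel) {t} ≤t t≤ = ∈-++⁺ʳ _ member
    where
    split : suc d * suc x₀ + rest ≡ suc d + (suc d * x₀ + rest)
    split = trans (cong (_+ rest) (ℕₚ.*-suc (suc d) x₀)) (ℕₚ.+-assoc (suc d) (suc d * x₀) rest)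
    ≤t′ : suc d + (suc d * x₀ + rest) ≤ t
    ≤t′ = subst (_≤ t) split ≤t
    member : (suc x₀ ∷ tabulate (x ∘ suc)) ∈ lightVectors⁺ (suc d) t (suc fuel)
    member rewrite dec-true (suc d ℕ.≤? t) (ℕₚ.≤-trans (ℕₚ.m≤m+n (suc d) _) ≤t′) =
      ∈-map⁺ incrementHead (go x₀ fuel
        (ℕₚ.m+n≤o⇒m≤o∸n _ (subst (_≤ t) (ℕₚ.+-comm (suc d) _) ≤t′))
        (ℕₚ.≤-trans (ℕₚ.∸-monoˡ-≤ (suc d) t≤) (ℕₚ.m∸n≤m fuel d)))

-- The product (K + 1) ... (K + d), that is, d! times the binomial coefficient "K + d choose d".
rising : ℕ → ℕ → ℕ
rising K zero    = 1
rising K (suc d) = (K + suc d) * rising K d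

rising-suc : ∀ K d → rising K (suc d) ≡ suc K * rising (suc K) d
rising-suc K zero    = fact K
  where
  fact : ∀ K → (K + 1) * 1 ≡ suc K * 1
  fact = ℕ-Solver.solve-∀
rising-suc K (suc d) = trans (cong ((K + suc (suc d)) *_) (rising-suc K d)) (fact K d (rising (suc K) d))
  where
  fact : ∀ K d x → (K + suc (suc d)) * (suc K * x) ≡ suc K * ((suc K + suc d) * x)
  fact = ℕ-Solver.solve-∀

-- A binomial coefficient is at most the number of all subsets; the induction is Pascal's rule
-- multiplied by d!.
rising≤ : ∀ K d → rising K d ≤ 2 ^ (K + d) * d !
rising≤ K zero = ℕₚ.≤-trans (ℕₚ.m^n>0 2 (K + 0)) (ℕₚ.≤-reflexive (sym (ℕₚ.*-identityʳ _)))
rising≤ zero (suc d) = begin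
  suc d * rising 0 d            ≤⟨ ℕₚ.*-monoʳ-≤ (suc d) (rising≤ zero d) ⟩
  suc d * (2 ^ d * d !)         ≡⟨ swap (suc d) (2 ^ d) (d !) ⟩
  2 ^ d * (suc d * d !)         ≤⟨ ℕₚ.*-monoˡ-≤ (suc d * d !) (ℕₚ.^-monoʳ-≤ 2 (ℕₚ.n≤1+n d)) ⟩
  2 ^ suc d * (suc d * d !)     ∎
  where
  open ℕₚ.≤-Reasoning
  swap : ∀ x y z → x * (y * z) ≡ y * (x * z)
  swap = ℕ-Solver.solve-∀
rising≤ (suc K) (suc d) = begin
  (suc K + suc d) * rising (suc K) d
    ≡⟨ ℕₚ.*-distribʳ-+ (rising (suc K) d) (suc K) (suc d) ⟩
  suc K * rising (suc K) d + suc d * rising (suc K) d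
    ≡⟨ cong (_+ suc d * rising (suc K) d) (rising-suc K d) ⟨
  rising K (suc d) + suc d * rising (suc K) d
    ≤⟨ ℕₚ.+-mono-≤ (rising≤ K (suc d)) (ℕₚ.*-monoʳ-≤ (suc d) (rising≤ (suc K) d)) ⟩
  2 ^ (K + suc d) * (suc d * d !) + suc d * (2 ^ (suc K + d) * d !)
    ≡⟨ cong (λ e → 2 ^ (K + suc d) * (suc d * d !) + suc d * (2 ^ e * d !)) (ℕₚ.+-suc K d) ⟨
  2 ^ (K + suc d) * (suc d * d !) + suc d * (2 ^ (K + suc d) * d !)
    ≡⟨ double (2 ^ (K + suc d)) (suc d) (d !) ⟩
  2 ^ (suc K + suc d) * (suc d * d !) ∎
  where
  open ℕₚ.≤-Reasoning
  double : ∀ x y z → x * (y * z) + y * (x * z) ≡ 2 * x * (y * z)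
  double = ℕ-Solver.solve-∀

bernoulli : ∀ K j → K ^ j * (K + j) ≤ K * suc K ^ j
bernoulli K zero = ℕₚ.≤-reflexive (fact K)
  where
  fact : ∀ K → 1 * (K + 0) ≡ K * 1
  fact = ℕ-Solver.solve-∀
bernoulli K (suc j) = begin
  K * K ^ j * (K + suc j)                ≡⟨ left K (K ^ j) j ⟩
  K * (K ^ j * (K + j)) + K * K ^ j      ≤⟨ ℕₚ.+-mono-≤ (ℕₚ.*-monoʳ-≤ K (bernoulli K j))
                                              (ℕₚ.*-monoʳ-≤ K (ℕₚ.^-monoˡ-≤ j (ℕₚ.n≤1+n K))) ⟩
  K * (K * suc K ^ j) + K * suc K ^ j    ≡⟨ right K (suc K ^ j) ⟩
  K * (suc K * suc K ^ j)                ∎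
  where
  open ℕₚ.≤-Reasoning
  left : ∀ K x j → K * x * (K + suc j) ≡ K * (x * (K + j)) + K * x
  left = ℕ-Solver.solve-∀
  right : ∀ K x → K * (K * x) + K * x ≡ K * (suc K * x)
  right = ℕ-Solver.solve-∀

-- The generating function of the light vectors is ∏ᵢ 1 / (1 − xⁱ); these
-- bounds are its value at x = K / (K + 1), where 1 / (1 − xⁱ) ≤ (K + i) / i by
-- Bernoulli's inequality.
length-incremented : ∀ K d t (vs : List (Vec ℕ (suc d))) (d≤?t : Dec (suc d ≤ t)) →
  length vs * (suc d ! * K ^ (t ∸ suc d)) ≤ suc K ^ (t ∸ suc d) * rising K (suc d) →
  length (if does d≤?t then List.map incrementHead vs else []) * (suc d ! * K ^ t) ≤ suc K ^ t * (K * rising K d)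
length-incremented K d t vs (no _)    ih = z≤n
length-incremented K d t vs (yes d≤t) ih = begin
  length (List.map incrementHead vs) * (suc d ! * K ^ t)
    ≡⟨ cong₂ (λ x e → x * (suc d ! * K ^ e)) (Listₚ.length-map incrementHead vs) t≡ ⟩
  L * (suc d ! * K ^ (suc d + t′))
    ≡⟨ cong (λ x → L * (suc d ! * x)) (ℕₚ.^-distribˡ-+-* K (suc d) t′) ⟩
  L * (suc d ! * (K ^ suc d * K ^ t′))
    ≡⟨ regroup L (suc d !) (K ^ suc d) (K ^ t′) ⟩
  K ^ suc d * (L * (suc d ! * K ^ t′))
    ≤⟨ ℕₚ.*-monoʳ-≤ (K ^ suc d) ih ⟩
  K ^ suc d * (suc K ^ t′ * ((K + suc d) * rising K d))
    ≡⟨ regroup′ (K ^ suc d) (suc K ^ t′) (K + suc d) (rising K d) ⟩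
  K ^ suc d * (K + suc d) * (suc K ^ t′ * rising K d)
    ≤⟨ ℕₚ.*-monoˡ-≤ (suc K ^ t′ * rising K d) (bernoulli K (suc d)) ⟩
  K * suc K ^ suc d * (suc K ^ t′ * rising K d)
    ≡⟨ regroup″ K (suc K ^ suc d) (suc K ^ t′) (rising K d) ⟩
  suc K ^ suc d * suc K ^ t′ * (K * rising K d)
    ≡⟨ cong (_* (K * rising K d)) (trans (cong (suc K ^_) t≡) (ℕₚ.^-distribˡ-+-* (suc K) (suc d) t′)) ⟨
  suc K ^ t * (K * rising K d) ∎
  where
  open ℕₚ.≤-Reasoning
  t′ = t ∸ suc d
  t≡ : t ≡ suc d + t′
  t≡ = sym (ℕₚ.m+[n∸m]≡n d≤t)
  L = length vs
  regroup : ∀ l f a b → l * (f * (a * b)) ≡ a * (l * (f * b))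
  regroup = ℕ-Solver.solve-∀
  regroup′ : ∀ a b c e → a * (b * (c * e)) ≡ a * c * (b * e)
  regroup′ = ℕ-Solver.solve-∀
  regroup″ : ∀ a b c e → a * b * (c * e) ≡ b * c * (a * e)
  regroup″ = ℕ-Solver.solve-∀

length-lightVectors : ∀ K d t fuel →
  length (lightVectors d t fuel) * (d ! * K ^ t) ≤ suc K ^ t * rising K d
length-lightVectors⁺ : ∀ K d t fuel →
  length (lightVectors⁺ d t fuel) * (d ! * K ^ t) ≤ suc K ^ t * (K * rising K (ℕ.pred d))

length-lightVectors K zero t fuel = begin
  1 * (1 * K ^ t)  ≡⟨ trans (ℕₚ.*-identityˡ _) (ℕₚ.*-identityˡ _) ⟩
  K ^ t            ≤⟨ ℕₚ.^-monoˡ-≤ t (ℕₚ.n≤1+n K) ⟩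
  suc K ^ t        ≡⟨ ℕₚ.*-identityʳ _ ⟨
  suc K ^ t * 1    ∎
  where open ℕₚ.≤-Reasoning
length-lightVectors K (suc d) t fuel = begin
  length (lightVectors (suc d) t fuel) * (suc d ! * K ^ t)
    ≡⟨ cong (_* (suc d ! * K ^ t)) (trans (Listₚ.length-++ (List.map (0 ∷_) (lightVectors d t t)))
         (cong (_+ L⁺) (Listₚ.length-map (0 ∷_) (lightVectors d t t)))) ⟩
  (L + L⁺) * (suc d * d ! * K ^ t)
    ≡⟨ expand L L⁺ (suc d) (d !) (K ^ t) ⟩
  suc d * (L * (d ! * K ^ t)) + L⁺ * (suc d ! * K ^ t)
    -- Vectors with zero head and with positive head claim the shares d + 1 and K of the new factor
    -- K + d + 1.
    ≤⟨ ℕₚ.+-mono-≤ (ℕₚ.*-monoʳ-≤ (suc d) (length-lightVectors K d t t)) (length-lightVectors⁺ K (suc d) t fuel) ⟩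
  suc d * (suc K ^ t * rising K d) + suc K ^ t * (K * rising K d)
    ≡⟨ collect (suc d) (suc K ^ t) (rising K d) K ⟩
  suc K ^ t * rising K (suc d) ∎
  where
  open ℕₚ.≤-Reasoning
  L  = length (lightVectors d t t)
  L⁺ = length (lightVectors⁺ (suc d) t fuel)
  expand : ∀ x y a b c → (x + y) * (a * b * c) ≡ a * (x * (b * c)) + y * (a * b * c)
  expand = ℕ-Solver.solve-∀
  collect : ∀ d a q K → d * (a * q) + a * (K * q) ≡ a * ((K + d) * q)
  collect = ℕ-Solver.solve-∀

length-lightVectors⁺ K zero    t fuel       = z≤n
length-lightVectors⁺ K (suc d) t zero       = z≤n
length-lightVectors⁺ K (suc d) t (suc fuel) =
  length-incremented K d t (lightVectors (suc d) (t ∸ suc d) fuel) (suc d ℕ.≤? t)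
    (length-lightVectors K (suc d) (t ∸ suc d) fuel)

-- (1 + 1/K)^j ≤ 1 / (1 - j/K), cleared of denominators with e = K - j. At j = K/2 the bound is 2.
reverse-bernoulli : ∀ K j e → j + e ≡ K → suc K ^ j * e ≤ K ^ j * K
reverse-bernoulli K zero    e refl = ℕₚ.≤-refl
reverse-bernoulli K (suc j) e eq = begin
  suc K * suc K ^ j * e    ≡⟨ regroup K (suc K ^ j) e ⟩
  suc K ^ j * (K * e + e)  ≤⟨ ℕₚ.*-monoʳ-≤ (suc K ^ j) (ℕₚ.+-monoʳ-≤ (K * e) (subst (e ≤_) eq (ℕₚ.m≤n+m e (suc j)))) ⟩
  suc K ^ j * (K * e + K)  ≡⟨ regroup′ K (suc K ^ j) e ⟩
  K * (suc K ^ j * suc e)  ≤⟨ ℕₚ.*-monoʳ-≤ K (reverse-bernoulli K j (suc e) (trans (ℕₚ.+-suc j e) eq)) ⟩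
  K * (K ^ j * K)          ≡⟨ ℕₚ.*-assoc K (K ^ j) K ⟨
  K * K ^ j * K            ∎
  where
  open ℕₚ.≤-Reasoning
  regroup : ∀ K x e → suc K * x * e ≡ x * (K * e + e)
  regroup = ℕ-Solver.solve-∀
  regroup′ : ∀ K x e → x * (K * e + K) ≡ K * (x * suc e)
  regroup′ = ℕ-Solver.solve-∀

^-distribʳ-* : ∀ x y n → (x * y) ^ n ≡ x ^ n * y ^ n
^-distribʳ-* x y zero    = refl
^-distribʳ-* x y (suc n) = trans (cong (x * y *_) (^-distribʳ-* x y n)) (regroup x y (x ^ n) (y ^ n))
  where
  regroup : ∀ x y a b → x * y * (a * b) ≡ x * a * (y * b)
  regroup = ℕ-Solver.solve-∀

-- The general bound is evaluated at K = 2k. As t = k · K, the power ((K + 1) / K)^t is at most 2^K,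
-- and the rising product divided by k! is at most 2^(K + k); the exponents 2k and 3k add up to 5k.
#lightVectors≤ : ∀ k → 0 < k → let t = k * (k + k) in length (lightVectors k t t) ≤ 2 ^ (5 * k)
#lightVectors≤ k 0<k = ℕₚ.*-cancelʳ-≤ _ _ (k ! * K ^ t) {{ℕ.>-nonZero (ℕₚ.*-mono-≤ (ℕₚ.1≤n! k) (ℕₚ.m^n>0 K {{K≢0}} t))}} (begin
  length (lightVectors k t t) * (k ! * K ^ t)   ≤⟨ length-lightVectors K k t t ⟩
  suc K ^ t * rising K k                        ≤⟨ ℕₚ.*-mono-≤ power (rising≤ K k) ⟩
  2 ^ K * K ^ t * (2 ^ (K + k) * k !)           ≡⟨ regroup (2 ^ K) (K ^ t) (2 ^ (K + k)) (k !) ⟩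
  2 ^ K * 2 ^ (K + k) * (k ! * K ^ t)           ≡⟨ cong (_* (k ! * K ^ t)) (trans (cong (2 ^_) (five k)) (ℕₚ.^-distribˡ-+-* 2 K (K + k))) ⟨
  2 ^ (5 * k) * (k ! * K ^ t)                   ∎)
  where
  open ℕₚ.≤-Reasoning
  K = k + k
  t = k * K
  instance
    K≢0 : ℕ.NonZero K
    K≢0 = ℕ.>-nonZero (ℕₚ.≤-trans 0<k (ℕₚ.m≤m+n k k))
  five : ∀ k → 5 * k ≡ k + k + (k + k + k)
  five = ℕ-Solver.solve-∀
  regroup : ∀ a b c e → a * b * (c * e) ≡ a * c * (e * b)
  regroup = ℕ-Solver.solve-∀
  base : suc K ^ k ≤ 2 * K ^ k
  base = ℕₚ.*-cancelʳ-≤ _ _ k {{ℕ.>-nonZero 0<k}}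
    (ℕₚ.≤-trans (reverse-bernoulli K k k refl) (ℕₚ.≤-reflexive (fact (K ^ k) k)))
    where
    fact : ∀ x k → x * (k + k) ≡ 2 * x * k
    fact = ℕ-Solver.solve-∀
  power : suc K ^ t ≤ 2 ^ K * K ^ t
  power = begin
    suc K ^ (k * K)          ≡⟨ ℕₚ.^-*-assoc (suc K) k K ⟨
    (suc K ^ k) ^ K          ≤⟨ ℕₚ.^-monoˡ-≤ K base ⟩
    (2 * K ^ k) ^ K          ≡⟨ ^-distribʳ-* 2 (K ^ k) K ⟩
    2 ^ K * (K ^ k) ^ K      ≡⟨ cong (2 ^ K *_) (ℕₚ.^-*-assoc K k K) ⟩
    2 ^ K * K ^ (k * K)      ∎

-- Light subset sums and the pigeonhole principle

∣sum∣≤ : ∀ {n} (x : Fin n → ℤ) → ℤ.∣ Σℤ.sum x ∣ ≤ Σℕ.sum (λ i → ℤ.∣ x i ∣)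
∣sum∣≤ {zero}  x = z≤n
∣sum∣≤ {suc n} x = ℕₚ.≤-trans (ℤₚ.∣i+j∣≤∣i∣+∣j∣ (x zero) _) (ℕₚ.+-monoʳ-≤ _ (∣sum∣≤ (x ∘ suc)))

totalWeight-mono : ∀ {d} {x y : Fin d → ℕ} → (∀ i → x i ≤ y i) → totalWeight x ≤ totalWeight y
totalWeight-mono {x = x} {y} x≤y = sum-mono-≤ λ i → ℕₚ.*-monoʳ-≤ (weight i) (x≤y i)

totalWeight-* : ∀ {d} q (x : Fin d → ℕ) → totalWeight (λ i → q * x i) ≡ q * totalWeight x
totalWeight-* q x = trans (Σℕ.sum-cong-≗ λ i → swap (weight i) q (x i)) (sym (Σℕ.*-distribˡ-sum q (λ i → weight i * x i)))
  where
  swap : ∀ a b c → a * (b * c) ≡ b * (a * c)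
  swap = ℕ-Solver.solve-∀

totalWeight-sum : ∀ {n d} (f : Fin n → Fin d → ℕ) →
  totalWeight (λ i → Σℕ.sum (λ j → f j i)) ≡ Σℕ.sum (λ j → totalWeight (f j))
totalWeight-sum f = trans (Σℕ.sum-cong-≗ λ i → Σℕ.*-distribˡ-sum (weight i) (λ j → f j i)) (Σℕ.∑-comm λ i j → weight i * f j i)

-- By `balance` the sum over `S` is the combination of the `v j` with coefficients `m j / q`, whose
-- total is `t`. Hence it weighs at most `t` times as much as a single vector may, however large `S`
-- is.
subsetSum-light : ∀ {n d t V} {v : Fin n → Fin d → ℤ} {S} → Weighting v S t →
  (∀ j → totalWeight (λ i → ℤ.∣ v j i ∣) ≤ V) → totalWeight (λ i → ℤ.∣ subsetSum v S i ∣) ≤ t * V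
subsetSum-light {n} {d} {t} {V} {v} {S} w light = ℕₚ.*-cancelˡ-≤ q {{ℕ.>-nonZero q>0}} (begin
  q * totalWeight (λ i → ℤ.∣ subsetSum v S i ∣)
    ≡⟨ totalWeight-* q (λ i → ℤ.∣ subsetSum v S i ∣) ⟨
  totalWeight (λ i → q * ℤ.∣ subsetSum v S i ∣)
    ≤⟨ totalWeight-mono pointwise ⟩
  totalWeight (λ i → Σℕ.sum (λ j → m j * ℤ.∣ v j i ∣))
    ≡⟨ totalWeight-sum (λ j i → m j * ℤ.∣ v j i ∣) ⟩
  Σℕ.sum (λ j → totalWeight (λ i → m j * ℤ.∣ v j i ∣))
    ≡⟨ Σℕ.sum-cong-≗ (λ j → totalWeight-* (m j) (λ i → ℤ.∣ v j i ∣)) ⟩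
  Σℕ.sum (λ j → m j * totalWeight (λ i → ℤ.∣ v j i ∣))
    ≤⟨ sum-mono-≤ (λ j → ℕₚ.*-monoʳ-≤ (m j) (light j)) ⟩
  Σℕ.sum (λ j → m j * V)
    ≡⟨ Σℕ.*-distribʳ-sum V m ⟨
  Σℕ.sum m * V
    ≡⟨ cong (_* V) total ⟩
  t * q * V
    ≡⟨ regroup t q V ⟩
  q * (t * V) ∎)
  where
  open Weighting w
  open ℕₚ.≤-Reasoning
  regroup : ∀ t q V → t * q * V ≡ q * (t * V)
  regroup = ℕ-Solver.solve-∀
  pointwise : ∀ i → q * ℤ.∣ subsetSum v S i ∣ ≤ Σℕ.sum (λ j → m j * ℤ.∣ v j i ∣)
  pointwise i = begin
    q * ℤ.∣ subsetSum v S i ∣                   ≡⟨ ℤₚ.abs-* (+ q) (subsetSum v S i) ⟨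
    ℤ.∣ + q ℤ.* subsetSum v S i ∣               ≡⟨ cong ℤ.∣_∣ (balance i) ⟨
    ℤ.∣ Σℤ.sum (λ j → + m j ℤ.* v j i) ∣        ≤⟨ ∣sum∣≤ (λ j → + m j ℤ.* v j i) ⟩
    Σℕ.sum (λ j → ℤ.∣ + m j ℤ.* v j i ∣)        ≡⟨ Σℕ.sum-cong-≗ (λ j → ℤₚ.abs-* (+ m j) (v j i)) ⟩
    Σℕ.sum (λ j → m j * ℤ.∣ v j i ∣)            ∎

record Chain {n d} (v : Fin n → Fin d → ℤ) (S : Subset n) (s : ℕ) : Set where
  field
    sets      : Fin (suc s) → Subset n
    weighting : ∀ i → Weighting v (sets i) d
    below     : ∀ i j → sets i j ≡ true → S j ≡ true
    nested    : ∀ {i i′} → i Fin.< i′ → ∀ j → sets i′ j ≡ true → sets i j ≡ true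
    strict    : ∀ {i i′} → i Fin.< i′ → ∃[ p ] sets i p ≡ true × sets i′ p ≡ false

∖-⊆ : ∀ {n} (S : Subset n) {p} j → (S ∖ p) j ≡ true → S j ≡ true
∖-⊆ S {p} j with does (p Fin.≟ j)
... | true  = λ ()
... | false = λ eq → eq

chain : ∀ s {n d} {v : Fin n → Fin d → ℤ} {S} → # S ≡ d + s → Weighting v S d → Chain v S s
chain zero {S = S} #S w = record
  { sets = λ _ → S ; weighting = λ _ → w ; below = λ _ _ eq → eq
  ; nested = λ _ _ eq → eq ; strict = λ { {zero} {zero} () } }
chain (suc s) {n} {d} {v} {S} #S w with step #S w
... | p , p∈S , w′ with chain s (ℕₚ.suc-injective (trans (sym (#-∖ S p∈S)) (trans #S (ℕₚ.+-suc d s)))) w′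
... | C = record { sets = sets′ ; weighting = weighting′ ; below = below′ ; nested = nested′ ; strict = strict′ }
  where
  open Chain C
  sets′ : Fin (suc (suc s)) → Subset n
  sets′ zero    = S
  sets′ (suc i) = sets i
  weighting′ : ∀ i → Weighting v (sets′ i) d
  weighting′ zero    = w
  weighting′ (suc i) = weighting i
  below′ : ∀ i j → sets′ i j ≡ true → S j ≡ true
  below′ zero    j eq = eq
  below′ (suc i) j eq = ∖-⊆ S {p} j (below i j eq)
  nested′ : ∀ {i i′} → i Fin.< i′ → ∀ j → sets′ i′ j ≡ true → sets′ i j ≡ true
  nested′ {zero}  {i′}     _         j eq = below′ i′ j eq
  nested′ {suc i} {suc i′} (s≤s i<i′) j eq = nested i<i′ j eq
  strict′ : ∀ {i i′} → i Fin.< i′ → ∃[ p ] sets′ i p ≡ true × sets′ i′ p ≡ false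
  strict′ {zero} {suc i′} _ with sets i′ p in eq
  ... | false = p , p∈S , eq
  ... | true  = contradiction (trans (sym (below i′ p eq)) (∖-self S p)) λ ()
  strict′ {suc i} {suc i′} (s≤s i<i′) = strict i<i′

-- All elements of `S` get the same complement d / |S|; both sides of the balance vanish because the
-- whole sum does.
initialWeighting : ∀ {n d} {v : Fin n → Fin d → ℤ} (S : Subset n) → 0 < # S → d ≤ # S →
                   (∀ i → subsetSum v S i ≡ 0ℤ) → Weighting v S d
initialWeighting {n} {d} {v} S 0<#S d≤#S ΣS≡0 = record
  { q = # S ; m = λ j → d * 𝟙 (S j) ; q>0 = 0<#S
  ; m≤q = λ j → ℕₚ.≤-trans (ℕₚ.*-monoʳ-≤ d (𝟙≤1 (S j))) (ℕₚ.≤-trans (ℕₚ.≤-reflexive (ℕₚ.*-identityʳ d)) d≤#S)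
  ; outside = λ j j∉S → trans (cong (λ b → d * 𝟙 b) j∉S) (ℕₚ.*-zeroʳ d)
  ; total = sym (Σℕ.*-distribˡ-sum d (𝟙 ∘ S))
  ; balance = λ i → begin
      Σℤ.sum (λ j → + (d * 𝟙 (S j)) ℤ.* v j i)
        ≡⟨ Σℤ.sum-cong-≗ (λ j → trans (cong (ℤ._* v j i) (ℤₚ.pos-* d (𝟙 (S j)))) (ℤₚ.*-assoc (+ d) (+ 𝟙 (S j)) (v j i))) ⟩
      Σℤ.sum (λ j → + d ℤ.* (+ 𝟙 (S j) ℤ.* v j i))
        ≡⟨ Σℤ.*-distribˡ-sum (+ d) (λ j → + 𝟙 (S j) ℤ.* v j i) ⟨
      + d ℤ.* subsetSum v S i
        ≡⟨ trans (cong (+ d ℤ.*_) (ΣS≡0 i)) (ℤₚ.*-zeroʳ (+ d)) ⟩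
      0ℤ
        ≡⟨ trans (cong (+ # S ℤ.*_) (ΣS≡0 i)) (ℤₚ.*-zeroʳ (+ # S)) ⟨
      + # S ℤ.* subsetSum v S i ∎
  }
  where open ≡-Reasoning

pigeonhole-∈ : ∀ {A : Set} {n} (xs : List A) (f : Fin n → A) → (∀ i → f i ∈ xs) → length xs < n →
               ∃₂ λ i j → i Fin.< j × f i ≡ f j
pigeonhole-∈ xs f f∈ len with pigeonhole len (Any.index ∘ f∈)
... | i , j , i<j , eq = i , j , i<j ,
  trans (lookup-index (f∈ i)) (trans (cong (List.lookup xs) eq) (sym (lookup-index (f∈ j))))

length-cartesianProduct : ∀ {A B : Set} (xs : List A) (ys : List B) →
                          length (cartesianProduct xs ys) ≡ length xs * length ys
length-cartesianProduct []       ys = refl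
length-cartesianProduct (x ∷ xs) ys = trans (Listₚ.length-++ (List.map (x ,_) ys))
  (cong₂ _+_ (Listₚ.length-map (x ,_) ys) (length-cartesianProduct xs ys))

bools : List Bool
bools = true ∷ false ∷ []

∈-bools : ∀ b → b ∈ bools
∈-bools true  = here refl
∈-bools false = there (here refl)

record ZeroSumPart {n d} (v : Fin n → Fin d → ℤ) (S : Subset n) (a b c : Fin n) : Set where
  field
    part      : Subset n
    part⊆     : ∀ j → part j ≡ true → S j ≡ true
    inhabited : ∃[ p ] part p ≡ true
    zeroSum   : ∀ i → subsetSum v part i ≡ 0ℤ
    a∉ : part a ≡ false
    b∉ : part b ≡ false
    c∉ : part c ≡ false

zeroSumPart : ∀ {k n} (v : Fin n → Fin k → ℤ) (S : Subset n) (a b c : Fin n) → 0 < k →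
  (∀ j → totalWeight (λ i → ℤ.∣ v j i ∣) ≤ k + k) → (∀ i → subsetSum v S i ≡ 0ℤ) →
  let N = length (lightVectors k (k * (k + k)) (k * (k + k))) in
  k + N * N * 8 ≤ # S → ZeroSumPart v S a b c
zeroSumPart {k} {n} v S a b c 0<k light ΣS≡0 large = record
  { part = T
  ; part⊆ = λ j eq → below i j (∧-trueˡ (sets i j) eq)
  ; inhabited = p , T-p
  ; zeroSum = T-zero
  ; a∉ = ∧-not-self (cong (proj₁ ∘ proj₂ ∘ proj₂) same)
  ; b∉ = ∧-not-self (cong (proj₁ ∘ proj₂ ∘ proj₂ ∘ proj₂) same)
  ; c∉ = ∧-not-self (cong (proj₂ ∘ proj₂ ∘ proj₂ ∘ proj₂) same)
  }
  where
  t = k * (k + k)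
  vecs = lightVectors k t t
  s = # S ∸ k
  k≤#S : k ≤ # S
  k≤#S = ℕₚ.≤-trans (ℕₚ.m≤m+n k _) large
  C : Chain v S s
  C = chain s (sym (ℕₚ.m+[n∸m]≡n k≤#S)) (initialWeighting S (ℕₚ.≤-trans 0<k k≤#S) k≤#S ΣS≡0)
  open Chain C
  -- A sum is recorded by its positive and its negative part, both of them light vectors of
  -- naturals.
  codes = cartesianProduct vecs (cartesianProduct vecs (cartesianProduct bools (cartesianProduct bools bools)))
  -- The last three components keep a, b and c out of the difference of two sets
  -- with the same code.
  code : Fin (suc s) → Vec ℕ k × Vec ℕ k × Bool × Bool × Bool
  code i = tabulate (λ r → subsetSum v (sets i) r ⁺) , tabulate (λ r → subsetSum v (sets i) r ⁻) , sets i a , sets i b , sets i c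
  light-part : ∀ i (f : ℤ → ℕ) → (∀ x → f x ≤ ℤ.∣ x ∣) → tabulate (λ r → f (subsetSum v (sets i) r)) ∈ vecs
  light-part i f f≤ = lightVectors-complete (λ r → f (subsetSum v (sets i) r))
    (ℕₚ.≤-trans (totalWeight-mono λ r → f≤ (subsetSum v (sets i) r)) (subsetSum-light (weighting i) light)) ℕₚ.≤-refl
  ⁺≤ : ∀ x → x ⁺ ≤ ℤ.∣ x ∣
  ⁺≤ x = subst (x ⁺ ≤_) (⁺+⁻≡∣∣ x) (ℕₚ.m≤m+n (x ⁺) (x ⁻))
  ⁻≤ : ∀ x → x ⁻ ≤ ℤ.∣ x ∣
  ⁻≤ x = subst (x ⁻ ≤_) (⁺+⁻≡∣∣ x) (ℕₚ.m≤n+m (x ⁻) (x ⁺))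
  code∈ : ∀ i → code i ∈ codes
  code∈ i = ∈-cartesianProduct⁺ (light-part i _⁺ ⁺≤) (∈-cartesianProduct⁺ (light-part i _⁻ ⁻≤)
    (∈-cartesianProduct⁺ (∈-bools (sets i a)) (∈-cartesianProduct⁺ (∈-bools (sets i b)) (∈-bools (sets i c)))))
  #codes : length codes ≡ length vecs * length vecs * 8
  #codes = trans (length-cartesianProduct vecs _) (trans (cong (length vecs *_) (length-cartesianProduct vecs _))
    (sym (ℕₚ.*-assoc (length vecs) (length vecs) 8)))
  enough : length codes < suc s
  -- There are at most `s` codes, and the chain has one set more than `s`.
  enough = s≤s (subst (_≤ s) (sym #codes) (subst (_≤ s) (ℕₚ.m+n∸m≡n k _) (ℕₚ.∸-monoˡ-≤ k large)))
  clash = pigeonhole-∈ codes code code∈ enough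
  i  = proj₁ clash
  i′ = proj₁ (proj₂ clash)
  i<i′ = proj₁ (proj₂ (proj₂ clash))
  same : code i ≡ code i′
  same = proj₂ (proj₂ (proj₂ clash))
  T : Subset n
  T j = sets i j ∧ not (sets i′ j)
  p = proj₁ (strict i<i′)
  T-p : T p ≡ true
  T-p = cong₂ (λ x y → x ∧ not y) (proj₁ (proj₂ (strict i<i′))) (proj₂ (proj₂ (strict i<i′)))
  ∧-trueˡ : ∀ x {y} → x ∧ y ≡ true → x ≡ true
  ∧-trueˡ true _ = refl
  ∧-not-self : ∀ {x y} → x ≡ y → x ∧ not y ≡ false
  ∧-not-self {true}  refl = refl
  ∧-not-self {false} refl = refl
  sums-agree : ∀ r → subsetSum v (sets i) r ≡ subsetSum v (sets i′) r
  sums-agree r = trans (⁺-⁻ (subsetSum v (sets i) r))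
    (trans (cong₂ (λ x y → + x ℤ.- + y) (entry _⁺ (cong proj₁ same)) (entry _⁻ (cong (proj₁ ∘ proj₂) same)))
      (sym (⁺-⁻ (subsetSum v (sets i′) r))))
    where
    entry : ∀ (f : ℤ → ℕ) → tabulate (λ r → f (subsetSum v (sets i) r)) ≡ tabulate (λ r → f (subsetSum v (sets i′) r)) →
            f (subsetSum v (sets i) r) ≡ f (subsetSum v (sets i′) r)
    entry f eq = trans (sym (lookup∘tabulate (λ r → f (subsetSum v (sets i) r)) r))
      (trans (cong (λ x → lookup x r) eq) (lookup∘tabulate (λ r → f (subsetSum v (sets i′) r)) r))
  split : ∀ x y z → (y ≡ true → x ≡ true) → + 𝟙 x ℤ.* z ≡ + 𝟙 (x ∧ not y) ℤ.* z ℤ.+ + 𝟙 y ℤ.* z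
  split true  true  z _ = sym (trans (cong (ℤ._+ ℤ.1ℤ ℤ.* z) (ℤₚ.*-zeroˡ z)) (ℤₚ.+-identityˡ _))
  split true  false z _ = sym (trans (cong (λ x → ℤ.1ℤ ℤ.* z ℤ.+ x) (ℤₚ.*-zeroˡ z)) (ℤₚ.+-identityʳ _))
  split false false z _ = sym (trans (cong (ℤ._+ 0ℤ ℤ.* z) (ℤₚ.*-zeroˡ z)) (ℤₚ.+-identityˡ _))
  split false true  z f = contradiction (f refl) λ ()
  T-zero : ∀ r → subsetSum v T r ≡ 0ℤ
  T-zero r = ∙-cancelʳ (subsetSum v (sets i′) r) _ _ (begin
    subsetSum v T r ℤ.+ subsetSum v (sets i′) r
      ≡⟨ Σℤ.∑-distrib-+ (λ j → + 𝟙 (T j) ℤ.* v j r) _ ⟨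
    Σℤ.sum (λ j → + 𝟙 (T j) ℤ.* v j r ℤ.+ + 𝟙 (sets i′ j) ℤ.* v j r)
      ≡⟨ Σℤ.sum-cong-≗ (λ j → split (sets i j) (sets i′ j) (v j r) (nested i<i′ j)) ⟨
    subsetSum v (sets i) r
      ≡⟨ sums-agree r ⟩
    subsetSum v (sets i′) r
      ≡⟨ ℤₚ.+-identityˡ _ ⟨
    0ℤ ℤ.+ subsetSum v (sets i′) r ∎)
    where
    open ≡-Reasoning
    open import Algebra.Properties.Group (AbelianGroup.group ℤₚ.+-0-abelianGroup) using (∙-cancelʳ)

-- Remapping events

count-sum : ∀ {A : Set} {p} {P : Pred A p} (P? : Decidable P) {n} (xs : Vec A n) →
            count P? xs ≡ # (λ i → does (P? (lookup xs i)))
count-sum P? []       = refl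
count-sum P? (x ∷ xs) with does (P? x)
... | true  = cong suc (count-sum P? xs)
... | false = count-sum P? xs

count-allFin : ∀ {n p} {P : Pred (Fin n) p} (P? : Decidable P) → count P? (Vec.allFin n) ≡ # (does ∘ P?)
count-allFin {n} P? = trans (count-sum P? (Vec.allFin n))
  (Σℕ.sum-cong-≗ λ i → cong (λ j → 𝟙 (does (P? j))) (lookup-allFin i))

-- Greedy pairing: the value `f zero` occurs in `g` because its count is positive, and removing the
-- two paired positions lowers the counts on both sides alike.
matching : ∀ {A : Set} (_≟ᴬ_ : DecidableEquality A) {n} (f g : Fin n → A) →
           (∀ a → # (λ i → does (f i ≟ᴬ a)) ≡ # (λ i → does (g i ≟ᴬ a))) →
           ∃[ π ] ∀ i → g (π ⟨$⟩ʳ i) ≡ f i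
matching _≟ᴬ_ {zero}  f g same = Perm.id , λ ()
matching {A} _≟ᴬ_ {suc n} f g same with #-inhabited (λ j → does (g j ≟ᴬ f zero))
  (subst (0 <_) (trans (cong (λ b → 𝟙 b + # (λ i → does (f (suc i) ≟ᴬ f zero))) (sym (dec-true (f zero ≟ᴬ f zero) refl))) (same (f zero))) (s≤s z≤n))
... | j , gⱼ≡ with matching _≟ᴬ_ (f ∘ suc) (g ∘ punchIn j) same′
  where
  same′ : ∀ a → # (λ i → does (f (suc i) ≟ᴬ a)) ≡ # (λ i → does (g (punchIn j i) ≟ᴬ a))
  same′ a = ℕₚ.+-cancelˡ-≡ (𝟙 (does (f zero ≟ᴬ a))) _ _
    (trans (same a) (trans (Σℕ.sum-remove {i = j} (λ i → 𝟙 (does (g i ≟ᴬ a))))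
      (cong (λ x → 𝟙 (does (x ≟ᴬ a)) + # (λ i → does (g (punchIn j i) ≟ᴬ a))) (does-true (g j ≟ᴬ f zero) gⱼ≡))))
... | π , πf = Perm.insert zero j π , λ where
  zero    → does-true (g j ≟ᴬ f zero) gⱼ≡
  (suc i) → trans (cong g (Perm.insert-punchIn zero j π i)) (πf i)

sum-fibres : ∀ {m n} (f : Fin m → Fin n) (g : Fin n → ℕ) →
  Σℕ.sum (g ∘ f) ≡ Σℕ.sum (λ y → # (λ x → does (f x ≟ y)) * g y)
sum-fibres {m} {n} f g = begin
  Σℕ.sum (g ∘ f)
    ≡⟨ Σℕ.sum-cong-≗ (λ x → sum-only ℕₚ.+-0-commutativeMonoid g (f x)) ⟨
  Σℕ.sum (λ x → Σℕ.sum (λ y → if does (f x ≟ y) then g y else 0))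
    ≡⟨ Σℕ.∑-comm (λ x y → if does (f x ≟ y) then g y else 0) ⟩
  Σℕ.sum (λ y → Σℕ.sum (λ x → if does (f x ≟ y) then g y else 0))
    ≡⟨ Σℕ.sum-cong-≗ (λ y → trans (Σℕ.sum-cong-≗ (λ x → as-product (does (f x ≟ y)) (g y)))
         (sym (Σℕ.*-distribʳ-sum (g y) (λ x → 𝟙 (does (f x ≟ y)))))) ⟩
  Σℕ.sum (λ y → # (λ x → does (f x ≟ y)) * g y) ∎
  where
  open ≡-Reasoning
  as-product : ∀ b x → (if b then x else 0) ≡ 𝟙 b * x
  as-product true  x = sym (ℕₚ.+-identityʳ x)
  as-product false x = refl

weight>0 : ∀ {d} (i : Fin d) → 0 < weight i
weight>0 {suc d} zero    = s≤s z≤n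
weight>0 {suc d} (suc i) = weight>0 i

weight≤ : ∀ {d} (i : Fin d) → weight i ≤ d
weight≤ {suc d} zero    = ℕₚ.≤-refl
weight≤ {suc d} (suc i) = ℕₚ.≤-trans (weight≤ i) (ℕₚ.n≤1+n d)

weight-surjective : ∀ {d s} → 0 < s → s ≤ d → ∃[ i ] weight {d} i ≡ s
weight-surjective {zero}  0<s s≤0 = contradiction (ℕₚ.<-≤-trans 0<s s≤0) λ ()
weight-surjective {suc d} {s} 0<s s≤d with s ℕ.≟ suc d
... | yes refl = zero , refl
... | no s≢ with i , eq ← weight-surjective {d} 0<s (ℕₚ.≤-pred (ℕₚ.≤∧≢⇒< s≤d s≢)) = suc i , eq

totalWeight-single : ∀ d x → totalWeight {d} (λ i → 𝟙 (does (x ℕ.≟ weight i))) ≤ x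
totalWeight-single zero    x = z≤n
totalWeight-single (suc d) x with x ℕ.≟ suc d
... | no x≢    = ℕₚ.≤-trans (ℕₚ.≤-reflexive (head-term (dec-false (x ℕ.≟ suc d) x≢))) (totalWeight-single d x)
  where
  tail-sum = totalWeight {d} (λ i → 𝟙 (does (x ℕ.≟ weight i)))
  head-term : ∀ {b} → b ≡ false → suc d * 𝟙 b + tail-sum ≡ tail-sum
  head-term refl = cong (_+ tail-sum) (ℕₚ.*-zeroʳ (suc d))
... | yes refl = ℕₚ.≤-reflexive (trans (cong₂ _+_ (trans (cong (λ b → suc d * 𝟙 b) (dec-true (suc d ℕ.≟ suc d) refl)) (ℕₚ.*-identityʳ (suc d)))
    (sum-≈ε ℕₚ.+-0-commutativeMonoid {n = d} λ i →
      trans (cong (λ b → weight i * 𝟙 b) (dec-false (suc d ℕ.≟ weight i) (ℕₚ.>⇒≢ (s≤s (weight≤ i))))) (ℕₚ.*-zeroʳ (weight i))))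
    (ℕₚ.+-identityʳ (suc d)))

module _ (ℓ k : ℕ) where

  merge-cases : ∀ u v (R : Partition ℓ k) w →
    (R w ≡ R v × merge ℓ k u v R w ≡ R u) ⊎ (R w ≢ R v × merge ℓ k u v R w ≡ R w)
  merge-cases u v R w with R w ≟ R v
  ... | yes eq = inj₁ (eq , refl)
  ... | no ne  = inj₂ (ne , refl)

  merge-outside : ∀ {u v} {R : Partition ℓ k} {w} → R w ≢ R v → merge ℓ k u v R w ≡ R w
  merge-outside {u} {v} {R} {w} ne rewrite dec-false (R w ≟ R v) ne = refl

  merge-idempotent : ∀ {u v} {R : Partition ℓ k} → (∀ w → R (R w) ≡ R w) → R u ≢ R v →
                     ∀ w → merge ℓ k u v R (merge ℓ k u v R w) ≡ merge ℓ k u v R w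
  merge-idempotent {u} {v} {R} idempotent Ru≢Rv w with merge-cases u v R w
  ... | inj₁ (_ , eq)  rewrite eq = trans (merge-outside {R = R} (λ e → Ru≢Rv (trans (sym (idempotent u)) e))) (idempotent u)
  ... | inj₂ (ne , eq) rewrite eq = trans (merge-outside {R = R} (λ e → ne (trans (sym (idempotent w)) e))) (idempotent w)

-- By `idempotent` every label in use is a node of its own component, so the cluster of a component
-- can be read off by applying the mapping to its label.
record Reachable (ℓ k : ℕ) (M : Mapping ℓ k) (R : Partition ℓ k) : Set where
  field
    idempotent : ∀ w → R (R w) ≡ R w
    invariant  : Invariant ℓ k R M

_≟ᴸ_ : DecidableEquality (Bool × ℕ)
(a , x) ≟ᴸ (b , y) = map′ (λ { (refl , refl) → refl }) (λ { refl → refl , refl }) ((a Bool.≟ b) ×-dec (x ℕ.≟ y))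

module Remapping {ℓ k : ℕ} (0<k : 0 < k) {M : Mapping ℓ k} (valid : Valid ℓ k M)
  {R : Partition ℓ k} {u v : Node ℓ k}
  (reachable : Reachable ℓ k M R) (Ru≢Rv : R u ≢ R v) (Mu≢Mv : lookup M u ≢ lookup M v)
  {M′ : Mapping ℓ k} (admissible : Admissible ℓ k (merge ℓ k u v R) M′) where

  open Reachable reachable

  n : ℕ
  n = ℓ * k

  R′ : Partition ℓ k
  R′ = merge ℓ k u v R

  ρ : Fin n
  ρ = R u

  P P′ : Fin n → Fin ℓ
  P  = lookup M
  P′ = lookup M′

  R′-idempotent : ∀ w → R′ (R′ w) ≡ R′ w
  R′-idempotent = merge-idempotent ℓ k idempotent Ru≢Rv

  R′u : R′ u ≡ ρ
  R′u = merge-outside ℓ k {R = R} Ru≢Rv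

  R′v : R′ v ≡ ρ
  R′v with merge-cases ℓ k u v R v
  ... | inj₁ (_ , eq) = eq
  ... | inj₂ (ne , _) = contradiction refl ne

  -- The merged component spans two clusters of `M`; its label lies in only one of them, hence the
  -- exception.
  P-root : ∀ w → R′ w ≢ ρ → P (R′ w) ≡ P w
  P-root w ne with merge-cases ℓ k u v R w
  ... | inj₁ (_ , eq) = contradiction eq ne
  ... | inj₂ (_ , eq) = trans (cong P eq) (invariant (R w) w (idempotent w))

  P′-root : ∀ w → P′ (R′ w) ≡ P′ w
  P′-root w = proj₂ admissible (R′ w) w (R′-idempotent w)

  merged-home : ∀ w → R′ w ≡ ρ → P w ≡ P u ⊎ P w ≡ P v
  merged-home w eq with merge-cases ℓ k u v R w
  ... | inj₁ (Rw≡Rv , _) = inj₂ (invariant w v Rw≡Rv)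
  ... | inj₂ (_ , eq′)   = inj₁ (invariant w u (trans (sym eq′) eq))

  cluster-size : ∀ c → # (λ w → does (P w ≟ c)) ≡ k
  cluster-size c = trans (sym (count-sum (_≟ c) M)) (valid c)

  cluster-size′ : ∀ c → # (λ w → does (P′ w ≟ c)) ≡ k
  cluster-size′ c = trans (sym (count-sum (_≟ c) M′)) (proj₁ admissible c)

  -- Components are represented by their labels, which are nodes; a label that
  -- is not in use has size 0.
  size : Fin n → ℕ
  size L = # λ w → does (R′ w ≟ L)

  size>0 : ∀ w → 0 < size (R′ w)
  size>0 w = ℕₚ.≤-trans (ℕₚ.≤-reflexive (cong 𝟙 (sym (dec-true (R′ w ≟ R′ w) refl))))
    (term≤sum (λ x → 𝟙 (does (R′ x ≟ R′ w))) w)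

  𝟙-≤ : ∀ {p q} {A : Set p} {B : Set q} (A? : Dec A) (B? : Dec B) → (A → B) → 𝟙 (does A?) ≤ 𝟙 (does B?)
  𝟙-≤ (no _)  B? f = z≤n
  𝟙-≤ (yes a) B? f = ℕₚ.≤-reflexive (sym (cong 𝟙 (dec-true B? (f a))))

  size≤k : ∀ L → size L ≤ k
  size≤k L = ℕₚ.≤-trans (sum-mono-≤ (λ w → 𝟙-≤ (R′ w ≟ L) (P′ w ≟ P′ L) (λ { refl → sym (P′-root w) })))
    (ℕₚ.≤-reflexive (cluster-size′ (P′ L)))

  -- Labels that are not in use never count, since no weight equals their size 0.
  typed : Fin k → Fin n → ℕ
  typed i L = 𝟙 (not (does (L ≟ ρ)) ∧ does (size L ℕ.≟ weight i))

  profile : (Fin n → Fin ℓ) → Fin ℓ → Fin k → ℕ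
  profile Q c i = Σℕ.sum λ L → 𝟙 (does (Q L ≟ c)) * typed i L

  profile-sum : ∀ Q (I : Subset ℓ) i →
    Σℕ.sum (λ c → 𝟙 (I c) * profile Q c i) ≡ Σℕ.sum (λ L → 𝟙 (I (Q L)) * typed i L)
  profile-sum Q I i = begin
    Σℕ.sum (λ c → 𝟙 (I c) * profile Q c i)
      ≡⟨ Σℕ.sum-cong-≗ (λ c → Σℕ.*-distribˡ-sum (𝟙 (I c)) (λ L → 𝟙 (does (Q L ≟ c)) * typed i L)) ⟩
    Σℕ.sum (λ c → Σℕ.sum (λ L → 𝟙 (I c) * (𝟙 (does (Q L ≟ c)) * typed i L)))
      ≡⟨ Σℕ.∑-comm (λ c L → 𝟙 (I c) * (𝟙 (does (Q L ≟ c)) * typed i L)) ⟩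
    Σℕ.sum (λ L → Σℕ.sum (λ c → 𝟙 (I c) * (𝟙 (does (Q L ≟ c)) * typed i L)))
      ≡⟨ Σℕ.sum-cong-≗ (λ L → trans (Σℕ.sum-cong-≗ (λ c → reshape (𝟙 (I c)) (does (Q L ≟ c)) (typed i L)))
           (sum-only ℕₚ.+-0-commutativeMonoid (λ c → 𝟙 (I c) * typed i L) (Q L))) ⟩
    Σℕ.sum (λ L → 𝟙 (I (Q L)) * typed i L) ∎
    where
    open ≡-Reasoning
    reshape : ∀ x b y → x * (𝟙 b * y) ≡ (if b then x * y else 0)
    reshape x true  y = cong (x *_) (ℕₚ.*-identityˡ y)
    reshape x false y = ℕₚ.*-zeroʳ x

  -- Counted with their sizes, the components in a cluster consist of nodes of this cluster, of
  -- which there are k. The condition on `Q` spares the merged component, so that it holds for `M`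
  -- as well as for `M′`.
  profile-light : ∀ Q → (∀ w → R′ w ≢ ρ → Q (R′ w) ≡ Q w) → (∀ c → # (λ w → does (Q w ≟ c)) ≡ k) →
                  ∀ c → totalWeight (profile Q c) ≤ k
  profile-light Q root cluster-size c = begin
    totalWeight (profile Q c)
      ≡⟨ totalWeight-sum (λ L i → 𝟙 (does (Q L ≟ c)) * typed i L) ⟩
    Σℕ.sum (λ L → totalWeight (λ i → 𝟙 (does (Q L ≟ c)) * typed i L))
      ≤⟨ sum-mono-≤ (λ L → per-label L) ⟩
    Σℕ.sum (λ L → size L * mass L)
      ≡⟨ sum-fibres R′ mass ⟨
    Σℕ.sum (λ w → mass (R′ w))
      ≤⟨ sum-mono-≤ (λ w → 𝟙-≤ ((Q (R′ w) ≟ c) ×-dec ¬? (R′ w ≟ ρ)) (Q w ≟ c) (λ (eq , ne) → trans (sym (root w ne)) eq)) ⟩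
    # (λ w → does (Q w ≟ c))
      ≡⟨ cluster-size c ⟩
    k ∎
    where
    open ℕₚ.≤-Reasoning
    mass : Fin n → ℕ
    mass L = 𝟙 (does (Q L ≟ c) ∧ not (does (L ≟ ρ)))
    factor : ∀ a b e → 𝟙 a * 𝟙 (b ∧ e) ≡ 𝟙 (a ∧ b) * 𝟙 e
    factor true  true  e = refl
    factor true  false e = refl
    factor false b     e = refl
    per-label : ∀ L → totalWeight (λ i → 𝟙 (does (Q L ≟ c)) * typed i L) ≤ size L * mass L
    per-label L = begin
      totalWeight {k} (λ i → 𝟙 (does (Q L ≟ c)) * typed i L)
        ≤⟨ totalWeight-mono {k} (λ i → ℕₚ.≤-reflexive (factor (does (Q L ≟ c)) (not (does (L ≟ ρ))) (does (size L ℕ.≟ weight i)))) ⟩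
      totalWeight {k} (λ i → mass L * 𝟙 (does (size L ℕ.≟ weight i)))
        ≡⟨ totalWeight-* {k} (mass L) (λ i → 𝟙 (does (size L ℕ.≟ weight i))) ⟩
      mass L * totalWeight {k} (λ i → 𝟙 (does (size L ℕ.≟ weight i)))
        ≤⟨ ℕₚ.*-monoʳ-≤ (mass L) (totalWeight-single k (size L)) ⟩
      mass L * size L
        ≡⟨ ℕₚ.*-comm (mass L) (size L) ⟩
      size L * mass L ∎

  D : Subset ℓ
  D c = does (affected? ℓ k M M′ c)

  D-false : ∀ {c} → D c ≡ false → ∀ w → does (P w ≟ c) ≡ does (P′ w ≟ c)
  D-false {c} c∉D w with P w ≟ c | P′ w ≟ c
  ... | yes _  | yes _  = refl
  ... | no _   | no _   = refl
  ... | yes eq | no ne  = contradiction (w , (λ e → ne (trans (sym e) eq)) , inj₁ eq) (does-false (affected? ℓ k M M′ c) c∉D)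
  ... | no ne  | yes eq = contradiction (w , (λ e → ne (trans e eq)) , inj₂ eq) (does-false (affected? ℓ k M M′ c) c∉D)

  change : Fin ℓ → Fin k → ℤ
  change c i = + profile P c i ℤ.- + profile P′ c i

  change-unaffected : ∀ {c} → D c ≡ false → ∀ i → change c i ≡ 0ℤ
  change-unaffected {c} c∉D i = trans
    (cong (λ x → + x ℤ.- + profile P′ c i) (Σℕ.sum-cong-≗ λ L → cong (λ b → 𝟙 b * typed i L) (D-false c∉D L)))
    (ℤₚ.+-inverseʳ (+ profile P′ c i))

  subset-change : ∀ (I : Subset ℓ) i → subsetSum change I i
    ≡ + Σℕ.sum (λ L → 𝟙 (I (P L)) * typed i L) ℤ.- + Σℕ.sum (λ L → 𝟙 (I (P′ L)) * typed i L)
  subset-change I i = trans (difference (𝟙 ∘ I) (λ c → profile P c i) (λ c → profile P′ c i))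
    (cong₂ (λ x y → + x ℤ.- + y) (profile-sum P I i) (profile-sum P′ I i))
    where
    difference : ∀ {m} (a x y : Fin m → ℕ) → Σℤ.sum (λ c → + a c ℤ.* (+ x c ℤ.- + y c))
                 ≡ + Σℕ.sum (λ c → a c * x c) ℤ.- + Σℕ.sum (λ c → a c * y c)
    difference {zero}  a x y = refl
    difference {suc m} a x y = trans
      (cong₂ ℤ._+_ (distrib (+ a zero) (+ x zero) (+ y zero)) (difference (a ∘ suc) (x ∘ suc) (y ∘ suc)))
      (trans (interchange (+ a zero ℤ.* + x zero) (+ a zero ℤ.* + y zero) (+ restˣ) (+ restʸ))
        (cong₂ (λ s t → (s ℤ.+ + restˣ) ℤ.- (t ℤ.+ + restʸ)) (sym (ℤₚ.pos-* (a zero) (x zero))) (sym (ℤₚ.pos-* (a zero) (y zero)))))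
      where
      restˣ = Σℕ.sum (λ c → a (suc c) * x (suc c))
      restʸ = Σℕ.sum (λ c → a (suc c) * y (suc c))
      distrib : ∀ a x y → a ℤ.* (x ℤ.- y) ≡ a ℤ.* x ℤ.- a ℤ.* y
      distrib = ℤ-Solver.solve-∀
      interchange : ∀ a b s t → (a ℤ.- b) ℤ.+ (s ℤ.- t) ≡ (a ℤ.+ s) ℤ.- (b ℤ.+ t)
      interchange = ℤ-Solver.solve-∀

  change-light : ∀ c → totalWeight (λ i → ℤ.∣ change c i ∣) ≤ k + k
  change-light c = begin
    totalWeight (λ i → ℤ.∣ change c i ∣)
      ≤⟨ totalWeight-mono (λ i → ℤₚ.∣i-j∣≤∣i∣+∣j∣ (+ profile P c i) (+ profile P′ c i)) ⟩
    totalWeight (λ i → profile P c i + profile P′ c i)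
      ≡⟨ trans (Σℕ.sum-cong-≗ (λ i → ℕₚ.*-distribˡ-+ (weight i) (profile P c i) (profile P′ c i)))
           (Σℕ.∑-distrib-+ (λ i → weight i * profile P c i) _) ⟩
    totalWeight (profile P c) + totalWeight (profile P′ c)
      ≤⟨ ℕₚ.+-mono-≤ (profile-light P P-root cluster-size c) (profile-light P′ (λ w _ → P′-root w) cluster-size′ c) ⟩
    k + k ∎
    where open ℕₚ.≤-Reasoning

  -- Unaffected clusters contribute zero, so only the affected members of a set of clusters matter.
  change-mask : ∀ (S T : Subset ℓ) → (∀ c → D c ≡ true → S c ≡ T c) → ∀ i → subsetSum change S i ≡ subsetSum change T i
  change-mask S T agree i = Σℤ.sum-cong-≗ pointwise
    where
    pointwise : ∀ c → + 𝟙 (S c) ℤ.* change c i ≡ + 𝟙 (T c) ℤ.* change c i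
    pointwise c with D c in eq
    ... | true  = cong (λ b → + 𝟙 b ℤ.* change c i) (agree c eq)
    ... | false = trans (vanish (S c)) (sym (vanish (T c)))
      where
      vanish : ∀ b → + 𝟙 b ℤ.* change c i ≡ 0ℤ
      vanish b = trans (cong (+ 𝟙 b ℤ.*_) (change-unaffected eq i)) (ℤₚ.*-zeroʳ (+ 𝟙 b))

  -- Summed over all clusters, the old and the new descriptions count every component other than the
  -- merged one exactly once, wherever it lies.
  change-total : ∀ i → subsetSum change D i ≡ 0ℤ
  change-total i = trans (change-mask D (λ _ → true) (λ _ eq → eq) i)
    (trans (subset-change (λ _ → true) i) (ℤₚ.+-inverseʳ (+ Σℕ.sum (λ L → 1 * typed i L))))

  affected-true : ∀ {c} w → P w ≢ P′ w → P w ≡ c ⊎ P′ w ≡ c → D c ≡ true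
  affected-true {c} w moved touches = dec-true (affected? ℓ k M M′ c) (w , moved , touches)

  P′u≡P′v : P′ u ≡ P′ v
  P′u≡P′v = proj₂ admissible u v (trans R′u (sym R′v))

  -- The new mapping unites `u` and `v`, so at least one of them moves: either `u` leaves its old
  -- cluster, or it stays and `v` enters that cluster. The next two lemmas argue alike.
  Pu∈D : D (P u) ≡ true
  Pu∈D with P′ u ≟ P u
  ... | no ne  = affected-true u (ne ∘ sym) (inj₁ refl)
  ... | yes eq = affected-true v (λ e → Mu≢Mv (sym (trans e (trans (sym P′u≡P′v) eq)))) (inj₂ (trans (sym P′u≡P′v) eq))

  Pv∈D : D (P v) ≡ true
  Pv∈D with P′ v ≟ P v
  ... | no ne  = affected-true v (ne ∘ sym) (inj₁ refl)
  ... | yes eq = affected-true u (λ e → Mu≢Mv (trans e (trans P′u≡P′v eq))) (inj₂ (trans P′u≡P′v eq))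

  P′u∈D : D (P′ u) ≡ true
  P′u∈D with P u ≟ P′ u
  ... | no ne  = affected-true u ne (inj₂ refl)
  ... | yes eq = affected-true v (λ e → Mu≢Mv (trans eq (trans P′u≡P′v (sym e)))) (inj₂ (sym P′u≡P′v))

  -- The exchange of components of equal size

  module Exchange (Z : ZeroSumPart change D (P u) (P v) (P′ u)) where
    open ZeroSumPart Z renaming (part to T)

    -- The clusters whose old contents are to be kept: besides `T` also the unaffected ones, so that
    -- no further cluster becomes affected.
    I : Subset ℓ
    I c = T c ∨ not (D c)

    I-excludes : ∀ {c} → T c ≡ false → D c ≡ true → I c ≡ false
    I-excludes c∉T c∈D = cong₂ (λ x y → x ∨ not y) c∉T c∈D

    balanced : ∀ i → Σℕ.sum (λ L → 𝟙 (I (P L)) * typed i L) ≡ Σℕ.sum (λ L → 𝟙 (I (P′ L)) * typed i L)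
    balanced i = ℤₚ.+-injective (ℤₚ.i-j≡0⇒i≡j _ _ (trans (sym (subset-change I i))
      (trans (change-mask I T (λ c c∈D → trans (cong (λ b → T c ∨ not b) c∈D) (∨-identityʳ (T c))) i) (zeroSum i))))

    kept : (Fin n → Fin ℓ) → Fin n → Bool
    kept Q L = I (Q L) ∧ (not (does (L ≟ ρ)) ∧ not (does (size L ℕ.≟ 0)))

    label : (Fin n → Fin ℓ) → Fin n → Bool × ℕ
    label Q L = kept Q L , size L

    kept-count : (Fin n → Fin ℓ) → Bool → ℕ → ℕ
    kept-count Q b s = # λ L → does (label Q L ≟ᴸ (b , s))

    kept-typed : ∀ Q i → kept-count Q true (weight i) ≡ Σℕ.sum (λ L → 𝟙 (I (Q L)) * typed i L)
    kept-typed Q i = Σℕ.sum-cong-≗ λ L → case (I (Q L)) (not (does (L ≟ ρ))) (size L)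
      where
      case : ∀ a b x → 𝟙 (does ((a ∧ (b ∧ not (does (x ℕ.≟ 0)))) Bool.≟ true) ∧ does (x ℕ.≟ weight i))
                       ≡ 𝟙 a * 𝟙 (b ∧ does (x ℕ.≟ weight i))
      case false b     x = refl
      case true  false x = refl
      case true  true zero    = sym (trans (ℕₚ.*-identityˡ _) (cong 𝟙 (dec-false (0 ℕ.≟ weight i) (ℕₚ.<⇒≢ (weight>0 i)))))
      case true  true (suc x) = sym (ℕₚ.+-identityʳ _)

    kept-none : ∀ Q s → (∀ L → kept Q L ≡ true → size L ≢ s) → kept-count Q true s ≡ 0
    kept-none Q s none = sum-≈ε ℕₚ.+-0-commutativeMonoid λ L →
      cong 𝟙 (dec-false (label Q L ≟ᴸ (true , s)) λ eq → none L (cong proj₁ eq) (cong proj₂ eq))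

    kept-split : ∀ Q s → kept-count Q true s + kept-count Q false s ≡ # (λ L → does (size L ℕ.≟ s))
    kept-split Q s = trans (sym (Σℕ.∑-distrib-+ (λ L → 𝟙 (does (label Q L ≟ᴸ (true , s)))) _))
      (Σℕ.sum-cong-≗ λ L → case (kept Q L) (does (size L ℕ.≟ s)))
      where
      case : ∀ a b → 𝟙 (does (a Bool.≟ true) ∧ b) + 𝟙 (does (a Bool.≟ false) ∧ b) ≡ 𝟙 b
      case true  b = ℕₚ.+-identityʳ (𝟙 b)
      case false b = refl

    kept-size≢0 : ∀ Q L → kept Q L ≡ true → size L ≢ 0
    kept-size≢0 Q L eq size≡0 = contradiction (trans (sym eq)
      (trans (cong (λ b → I (Q L) ∧ (not (does (L ≟ ρ)) ∧ not b)) (dec-true (size L ℕ.≟ 0) size≡0))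
             (trans (cong (I (Q L) ∧_) (∧-zeroʳ (not (does (L ≟ ρ))))) (∧-zeroʳ (I (Q L)))))) λ ()

    -- `balanced` speaks of the sizes 1 to k only, and no kept label has any other size.
    same-kept : ∀ s → kept-count P true s ≡ kept-count P′ true s
    same-kept s with s ℕ.≟ 0 | s ℕ.≤? k
    ... | yes refl | _ = trans (kept-none P 0 (kept-size≢0 P)) (sym (kept-none P′ 0 (kept-size≢0 P′)))
    ... | no _ | no s≰k = trans (kept-none P s (λ L _ → too-large L)) (sym (kept-none P′ s (λ L _ → too-large L)))
      where
      too-large : ∀ L → size L ≢ s
      too-large L refl = s≰k (size≤k L)
    ... | no s≢0 | yes s≤k with weight-surjective (ℕₚ.n≢0⇒n>0 s≢0) s≤k
    ...   | i , refl = trans (kept-typed P i) (trans (balanced i) (sym (kept-typed P′ i)))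

    same-labels : ∀ a → kept-count P (proj₁ a) (proj₂ a) ≡ kept-count P′ (proj₁ a) (proj₂ a)
    same-labels (true  , s) = same-kept s
    -- The number of all labels of size `s` does not depend on the mapping, so the labels that are
    -- not kept agree by subtraction.
    same-labels (false , s) = ℕₚ.+-cancelˡ-≡ (kept-count P true s) _ _
      (trans (kept-split P s) (trans (sym (kept-split P′ s)) (cong (_+ kept-count P′ false s) (sym (same-kept s)))))

    exchange = matching _≟ᴸ_ (label P) (label P′) same-labels
    π : Permutation n n
    π = proj₁ exchange

    kept-π : ∀ L → kept P′ (π ⟨$⟩ʳ L) ≡ kept P L
    kept-π L = cong proj₁ (proj₂ exchange L)

    size-π : ∀ L → size (π ⟨$⟩ʳ L) ≡ size L
    size-π L = cong proj₂ (proj₂ exchange L)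

    -- π matches the components that M keeps in I with those that M′ has in I;
    -- the remaining ones follow M′ through π.
    place : Fin n → Fin ℓ
    place L = if kept P L then P L else P′ (π ⟨$⟩ʳ L)

    M″ : Mapping ℓ k
    M″ = tabulate (place ∘ R′)

    P″ : ∀ w → lookup M″ w ≡ place (R′ w)
    P″ = lookup∘tabulate (place ∘ R′)

    kept-I : ∀ Q L → kept Q L ≡ true → I (Q L) ≡ true
    kept-I Q L eq with I (Q L)
    ... | true = refl

    kept-≢ρ : ∀ Q L → kept Q L ≡ true → L ≢ ρ
    kept-≢ρ Q L eq with I (Q L) | L ≟ ρ
    kept-≢ρ Q L eq | true | no ne = ne

    kept-intro : ∀ Q L → I (Q L) ≡ true → L ≢ ρ → size L ≢ 0 → kept Q L ≡ true
    kept-intro Q L i ne s = cong₂ _∧_ i (cong₂ (λ x y → not x ∧ not y) (dec-false (L ≟ ρ) ne) (dec-false (size L ℕ.≟ 0) s))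

    conflict : ∀ {b : Bool} → b ≡ true → b ≡ false → ∀ {A : Set} → A
    conflict refl ()

    root-ρ : P′ ρ ≡ P′ u
    root-ρ = trans (cong P′ (sym R′u)) (P′-root u)

    -- Both halves of the merged component lay outside `I`, so each component that `M` has in `c` is
    -- kept.
    stays : ∀ {c} → I c ≡ true → ∀ w → P w ≡ c → lookup M″ w ≡ c
    stays {c} c∈I w refl = trans (P″ w) (trans (cong (λ b → if b then P (R′ w) else P′ (π ⟨$⟩ʳ R′ w)) kept-w) (P-root w R′w≢ρ))
      where
      R′w≢ρ : R′ w ≢ ρ
      R′w≢ρ eq with merged-home w eq
      ... | inj₁ e = conflict c∈I (trans (cong I e) (I-excludes a∉ Pu∈D))
      ... | inj₂ e = conflict c∈I (trans (cong I e) (I-excludes b∉ Pv∈D))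
      kept-w : kept P (R′ w) ≡ true
      kept-w = kept-intro P (R′ w) (trans (cong I (P-root w R′w≢ρ)) c∈I) R′w≢ρ (ℕₚ.>⇒≢ (size>0 w))

    -- A component that is not kept cannot enter `c`: its image under `π` would lie in `I` under
    -- `M′`, so it would be either the merged component, whose new cluster is outside `I`, or a kept
    -- one, against `kept-π`.
    stays⁻¹ : ∀ {c} → I c ≡ true → ∀ w → lookup M″ w ≡ c → P w ≡ c
    stays⁻¹ {c} c∈I w eq = go (kept P L) refl
      where
      L = R′ w
      at : place L ≡ c
      at = trans (sym (P″ w)) eq
      go : ∀ b → kept P L ≡ b → P w ≡ c
      go true  kL = trans (sym (P-root w (kept-≢ρ P L kL))) (trans (cong (λ b → if b then P L else P′ (π ⟨$⟩ʳ L)) (sym kL)) at)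
      go false kL with (π ⟨$⟩ʳ L) ≟ ρ
      ... | yes πL≡ρ = conflict c∈I (trans (cong I (trans (sym at′) (trans (cong P′ πL≡ρ) root-ρ))) (I-excludes c∉ P′u∈D))
        where
        at′ : P′ (π ⟨$⟩ʳ L) ≡ c
        at′ = trans (cong (λ b → if b then P L else P′ (π ⟨$⟩ʳ L)) (sym kL)) at
      ... | no πL≢ρ = conflict (kept-intro P′ (π ⟨$⟩ʳ L) (trans (cong I at′) c∈I) πL≢ρ
                        (λ s≡0 → ℕₚ.>⇒≢ (size>0 w) (trans (sym (size-π L)) s≡0))) (trans (kept-π L) kL)
        where
        at′ : P′ (π ⟨$⟩ʳ L) ≡ c
        at′ = trans (cong (λ b → if b then P L else P′ (π ⟨$⟩ʳ L)) (sym kL)) at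

    -- A kept component lies in `I` under `M`, and its image under `π` lies in `I` under `M′`;
    -- neither is in `c`, so both sides are false.
    elsewhere : ∀ {c} → I c ≡ false → ∀ w → does (lookup M″ w ≟ c) ≡ does (P′ (π ⟨$⟩ʳ R′ w) ≟ c)
    elsewhere {c} c∉I w = trans (cong (λ x → does (x ≟ c)) (P″ w)) (go (kept P (R′ w)) refl)
      where
      L = R′ w
      go : ∀ b → kept P L ≡ b → does ((if kept P L then P L else P′ (π ⟨$⟩ʳ L)) ≟ c) ≡ does (P′ (π ⟨$⟩ʳ L) ≟ c)
      go false kL = cong (λ b → does ((if b then P L else P′ (π ⟨$⟩ʳ L)) ≟ c)) kL
      go true  kL = trans (cong (λ b → does ((if b then P L else P′ (π ⟨$⟩ʳ L)) ≟ c)) kL)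
        (trans (dec-false (P L ≟ c) (λ { refl → conflict (kept-I P L kL) c∉I }))
          (sym (dec-false (P′ (π ⟨$⟩ʳ L) ≟ c) (λ { refl → conflict (kept-I P′ (π ⟨$⟩ʳ L) (trans (kept-π L) kL)) c∉I }))))

    M″-size : ∀ c → # (λ w → does (lookup M″ w ≟ c)) ≡ k
    M″-size c = go (I c) refl
      where
      open ≡-Reasoning
      at : Fin n → ℕ
      at L = 𝟙 (does (P′ L ≟ c))
      go : ∀ b → I c ≡ b → # (λ w → does (lookup M″ w ≟ c)) ≡ k
      go true  c∈I = trans (Σℕ.sum-cong-≗ λ w → cong 𝟙 (does-⇔ (mk⇔ (stays⁻¹ c∈I w) (stays c∈I w)) (lookup M″ w ≟ c) (P w ≟ c))) (cluster-size c)
      -- Outside `I` the contents are those of `M′` up to a permutation of components that preserves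
      -- sizes, so the number of nodes is that of `M′`.
      go false c∉I = begin
        # (λ w → does (lookup M″ w ≟ c))                ≡⟨ Σℕ.sum-cong-≗ (λ w → cong 𝟙 (elsewhere c∉I w)) ⟩
        Σℕ.sum (λ w → at (π ⟨$⟩ʳ R′ w))                 ≡⟨ sum-fibres R′ (λ L → at (π ⟨$⟩ʳ L)) ⟩
        Σℕ.sum (λ L → size L * at (π ⟨$⟩ʳ L))           ≡⟨ Σℕ.sum-cong-≗ (λ L → cong (_* at (π ⟨$⟩ʳ L)) (sym (size-π L))) ⟩
        Σℕ.sum (λ L → size (π ⟨$⟩ʳ L) * at (π ⟨$⟩ʳ L))  ≡⟨ Σℕ.sum-permute (λ L → size L * at L) π ⟨
        Σℕ.sum (λ L → size L * at L)                    ≡⟨ sum-fibres R′ at ⟨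
        Σℕ.sum (λ w → at (R′ w))                        ≡⟨ Σℕ.sum-cong-≗ (λ w → cong (λ x → 𝟙 (does (x ≟ c))) (P′-root w)) ⟩
        # (λ w → does (P′ w ≟ c))                       ≡⟨ cluster-size′ c ⟩
        k                                               ∎

    M″-admissible : Admissible ℓ k R′ M″
    M″-admissible = (λ c → trans (count-sum (_≟ c) M″) (M″-size c))
                  , (λ x y eq → trans (P″ x) (trans (cong place eq) (sym (P″ y))))

    unaffected″ : ∀ {c} → I c ≡ true → ¬ Affected ℓ k M M″ c
    unaffected″ c∈I (w , moved , inj₁ eq) = moved (trans eq (sym (stays c∈I w eq)))
    unaffected″ c∈I (w , moved , inj₂ eq) = moved (trans (stays⁻¹ c∈I w eq) (sym eq))

    -- Nothing in `I` is affected by passing to `M″`, which leaves only members of `D` outside the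
    -- nonempty part `T`.
    fewer-affected : #affected ℓ k M M″ < #affected ℓ k M M′
    fewer-affected = subst₂ _<_ (sym (count-allFin (affected? ℓ k M M″))) (sym (count-allFin (affected? ℓ k M M′)))
      (sum-mono-< shrink (proj₁ inhabited)
        (subst₂ _<_ (cong 𝟙 (sym (dec-false (affected? ℓ k M M″ p) (unaffected″ (cong (_∨ not (D p)) (proj₂ inhabited))))))
                    (cong 𝟙 (sym (part⊆ p (proj₂ inhabited)))) (s≤s z≤n)))
      where
      p = proj₁ inhabited
      shrink : ∀ c → 𝟙 (does (affected? ℓ k M M″ c)) ≤ 𝟙 (D c)
      shrink c = 𝟙-mono λ c∉D → dec-false (affected? ℓ k M M″ c)
        (unaffected″ (trans (cong (λ b → T c ∨ not b) c∉D) (∨-zeroʳ (T c))))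

  improvable : let N = length (lightVectors k (k * (k + k)) (k * (k + k))) in
    k + N * N * 8 ≤ #affected ℓ k M M′ →
    ∃[ M″ ] Admissible ℓ k R′ M″ × #affected ℓ k M M″ < #affected ℓ k M M′
  improvable large = Exchange.M″ Z , Exchange.M″-admissible Z , Exchange.fewer-affected Z
    where
    Z : ZeroSumPart change D (P u) (P v) (P′ u)
    Z = zeroSumPart change D (P u) (P v) (P′ u) 0<k change-light change-total
          (ℕₚ.≤-trans large (ℕₚ.≤-reflexive (count-allFin (affected? ℓ k M M′))))

remap-small : ∀ {ℓ k} → 0 < k → ∀ {M M′ : Mapping ℓ k} {R u v} → Valid ℓ k M → Reachable ℓ k M R →
  R u ≢ R v → lookup M u ≢ lookup M v → Minimises (#affected ℓ k M) (Admissible ℓ k (merge ℓ k u v R)) M′ →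
  let N = length (lightVectors k (k * (k + k)) (k * (k + k))) in
  #affected ℓ k M M′ < k + N * N * 8
remap-small {ℓ} {k} 0<k {M} {M′} {R} {u} {v} valid reachable Ru≢Rv Mu≢Mv (admissible , least) = ℕₚ.≰⇒> λ large →
  let M″ , adm , fewer = Remapping.improvable {ℓ} {k} 0<k {M} valid {R} {u} {v} reachable Ru≢Rv Mu≢Mv {M′} admissible large
  in ℕₚ.<⇒≱ fewer (least M″ adm)

-- Competitiveness

module Competitiveness {ℓ k : ℕ} (0<k : 0 < k) where

  -- `B` bounds the clusters affected by a remapping, `W` the cost of a merging request (1 for the
  -- request and k per affected cluster), and `G` the cost of a phase: `W` for each of at most n
  -- merges, and 1 for the request that ends it.
  n N B W G : ℕ
  n = ℓ * k
  N = length (lightVectors k (k * (k + k)) (k * (k + k)))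
  B = k + N * N * 8
  W = 1 + k * B
  G = W * n + 1

  -- Every node that moves leaves an affected cluster, and a cluster has only k nodes to lose.
  migration≤ : ∀ (M M′ : Mapping ℓ k) → Valid ℓ k M → migrationCost ℓ k M M′ ≤ k * #affected ℓ k M M′
  migration≤ M M′ valid = begin
    migrationCost ℓ k M M′
      ≡⟨ count-allFin (λ w → ¬? (lookup M w ≟ lookup M′ w)) ⟩
    # (λ w → does (¬? (lookup M w ≟ lookup M′ w)))
      ≤⟨ sum-mono-≤ (λ w → 𝟙-mono λ unaffected → dec-false (¬? (lookup M w ≟ lookup M′ w))
           λ moved → does-false (affected? ℓ k M M′ (lookup M w)) unaffected (w , moved , inj₁ refl)) ⟩
    Σℕ.sum (λ w → 𝟙 (does (affected? ℓ k M M′ (lookup M w))))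
      ≡⟨ sum-fibres (lookup M) (λ c → 𝟙 (does (affected? ℓ k M M′ c))) ⟩
    Σℕ.sum (λ c → # (λ w → does (lookup M w ≟ c)) * 𝟙 (does (affected? ℓ k M M′ c)))
      ≡⟨ Σℕ.sum-cong-≗ (λ c → cong (_* 𝟙 (does (affected? ℓ k M M′ c))) (trans (sym (count-sum (_≟ c) M)) (valid c))) ⟩
    Σℕ.sum (λ c → k * 𝟙 (does (affected? ℓ k M M′ c)))
      ≡⟨ Σℕ.*-distribˡ-sum k (λ c → 𝟙 (does (affected? ℓ k M M′ c))) ⟨
    k * # (does ∘ affected? ℓ k M M′)
      ≡⟨ cong (k *_) (count-allFin (affected? ℓ k M M′)) ⟨
    k * #affected ℓ k M M′ ∎
    where open ℕₚ.≤-Reasoning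

  no-migration : ∀ (M : Mapping ℓ k) → migrationCost ℓ k M M ≡ 0
  no-migration M = trans (count-allFin (λ w → ¬? (lookup M w ≟ lookup M w)))
    (sum-≈ε ℕₚ.+-0-commutativeMonoid λ w → cong 𝟙 (dec-false (¬? (lookup M w ≟ lookup M w)) λ ne → ne refl))

  requestCost≤1 : ∀ (M : Mapping ℓ k) r → requestCost ℓ k M r ≤ 1
  requestCost≤1 M (u , v) with does (lookup M u ≟ lookup M v)
  ... | true  = z≤n
  ... | false = ℕₚ.≤-refl

  free-request : ∀ (M : Mapping ℓ k) {u v} → lookup M u ≡ lookup M v → requestCost ℓ k M (u , v) ≡ 0
  free-request M {u} {v} eq = cong (λ b → if b then 0 else 1) (dec-true (lookup M u ≟ lookup M v) eq)

  free-request⁻¹ : ∀ (M : Mapping ℓ k) {u v} → requestCost ℓ k M (u , v) ≡ 0 → lookup M u ≡ lookup M v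
  free-request⁻¹ M {u} {v} free with lookup M u ≟ lookup M v
  ... | yes eq = eq
  free-request⁻¹ M () | no _

  no-migration⁻¹ : ∀ (M M′ : Mapping ℓ k) → migrationCost ℓ k M M′ ≡ 0 → ∀ w → lookup M w ≡ lookup M′ w
  no-migration⁻¹ M M′ free w with lookup M w ≟ lookup M′ w
  ... | yes eq = eq
  ... | no ne  = contradiction (trans (sym (count-allFin (λ w → ¬? (lookup M w ≟ lookup M′ w)))) free)
    (ℕₚ.>⇒≢ (ℕₚ.≤-trans (ℕₚ.≤-reflexive (sym (cong 𝟙 (dec-true (¬? (lookup M w ≟ lookup M′ w)) ne))))
                        (term≤sum (λ w → 𝟙 (does (¬? (lookup M w ≟ lookup M′ w)))) w)))

  #components : Partition ℓ k → ℕ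
  #components R = # λ L → does (any? λ w → R w ≟ L)

  #components≤n : ∀ R → #components R ≤ n
  #components≤n R = ℕₚ.≤-trans (sum-mono-≤ (λ L → 𝟙≤1 (does (any? λ w → R w ≟ L))))
    (ℕₚ.≤-reflexive (trans (sum-const n) (ℕₚ.*-identityʳ n)))

  -- The label `R v` falls out of use and no label comes into use.
  merge-#components : ∀ {R : Partition ℓ k} {u v} → R u ≢ R v → #components (merge ℓ k u v R) < #components R
  merge-#components {R} {u} {v} Ru≢Rv = sum-mono-<
    (λ L → 𝟙-mono λ empty → dec-false (any? λ w → merge ℓ k u v R w ≟ L)
      λ (w , eq) → does-false (any? λ w → R w ≟ L) empty (covered w eq))
    (R v)
    (subst₂ _<_ (cong 𝟙 (sym (dec-false (any? λ w → merge ℓ k u v R w ≟ R v) λ (w , eq) → vanished w eq)))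
                (cong 𝟙 (sym (dec-true (any? λ w → R w ≟ R v) (v , refl)))) (s≤s z≤n))
    where
    covered : ∀ {L} w → merge ℓ k u v R w ≡ L → ∃[ w ] R w ≡ L
    covered w eq with merge-cases ℓ k u v R w
    ... | inj₁ (_ , eq′) = u , trans (sym eq′) eq
    ... | inj₂ (_ , eq′) = w , trans (sym eq′) eq
    vanished : ∀ w → merge ℓ k u v R w ≢ R v
    vanished w eq with merge-cases ℓ k u v R w
    ... | inj₁ (_ , eq′)  = Ru≢Rv (trans (sym eq′) eq)
    ... | inj₂ (ne , eq′) = ne (trans (sym eq′) eq)

  merge-invariant : ∀ M {R : Partition ℓ k} {u v} → Invariant ℓ k R M → lookup M u ≡ lookup M v →
                    Invariant ℓ k (merge ℓ k u v R) M
  merge-invariant M {R} {u} {v} inv Mu≡Mv x y eq with merge-cases ℓ k u v R x | merge-cases ℓ k u v R y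
  ... | inj₁ (x∈ , _)  | inj₁ (y∈ , _)  = trans (inv x v x∈) (sym (inv y v y∈))
  ... | inj₁ (x∈ , ex) | inj₂ (_ , ey)  = trans (inv x v x∈) (trans (sym Mu≡Mv) (inv u y (trans (sym ex) (trans eq ey))))
  ... | inj₂ (_ , ex)  | inj₁ (y∈ , ey) = trans (inv x u (trans (sym ex) (trans eq ey))) (trans Mu≡Mv (sym (inv y v y∈)))
  ... | inj₂ (_ , ex)  | inj₂ (_ , ey)  = inv x y (trans (sym ex) (trans eq ey))

  -- The offline player is charged G for a phase as soon as it first pays in
  -- it; until then its mapping respects the components of COMP.
  record Bounded (R : Partition ℓ k) (N : Mapping ℓ k) (comp opt : ℕ) : Set where
    field
      unpaid : Invariant ℓ k R N → comp ≤ W * #components R + G * opt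
      paid   : comp ≤ W * #components R + G * (opt + 1)
  open Bounded

  pay : ∀ {p} → p ≢ 0 → ∀ o → o + 1 ≤ p + o
  pay {p} p≢0 o = subst (_≤ p + o) (ℕₚ.+-comm 1 o) (ℕₚ.+-monoˡ-≤ o (ℕₚ.n≢0⇒n>0 p≢0))

  -- A request within a phase, with `W` times the number of components as potential, whose loss
  -- covers the cost of COMP. A free offline step preserves the invariant; a step with `p ≢ 0`
  -- supplies the extra unit that `paid` asks for.
  advance : ∀ {R R′ N N′ c comp p opt} → c + W * #components R′ ≤ W * #components R →
    (p ≡ 0 → Invariant ℓ k R N → Invariant ℓ k R′ N′) →
    Bounded R′ N′ comp opt → Bounded R N (c + comp) (p + opt)
  advance {R} {R′} {N} {N′} {c} {comp} {p} {opt} drop keep bounded = record { unpaid = unpaid′ ; paid = paid′ }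
    where
    raise : ∀ {x y} → comp ≤ W * #components R′ + G * x → x ≤ y → c + comp ≤ W * #components R + G * y
    raise {x} {y} le x≤y = ℕₚ.≤-trans (ℕₚ.+-monoʳ-≤ c le)
      (ℕₚ.≤-trans (ℕₚ.≤-reflexive (sym (ℕₚ.+-assoc c _ _))) (ℕₚ.+-mono-≤ drop (ℕₚ.*-monoʳ-≤ G x≤y)))
    unpaid′ : Invariant ℓ k R N → c + comp ≤ W * #components R + G * (p + opt)
    unpaid′ inv with p ℕ.≟ 0
    ... | yes p≡0 = raise (unpaid bounded (keep p≡0 inv)) (ℕₚ.m≤n+m opt p)
    ... | no p≢0  = raise (paid bounded) (pay p≢0 opt)
    paid′ : c + comp ≤ W * #components R + G * (p + opt + 1)
    paid′ = raise (paid bounded) (ℕₚ.+-monoˡ-≤ 1 (ℕₚ.m≤n+m opt p))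

  -- The request that ends a phase. One `G` covers this request and the fresh potential of the next
  -- phase, at most `W * n`. It is charged to the offline player, who either pays now or has the
  -- extra unit of `paid` left from an earlier payment.
  restart : ∀ {R N N′ c comp p opt} → c ≤ 1 → (Invariant ℓ k R N → p ≢ 0) →
    Bounded (singletons ℓ k) N′ comp opt → Bounded R N (c + comp) (p + opt)
  restart {R} {N} {N′} {c} {comp} {p} {opt} c≤1 pays bounded = record
    { unpaid = λ inv → raise (pay (pays inv) opt)
    ; paid   = raise (ℕₚ.+-monoˡ-≤ 1 (ℕₚ.m≤n+m opt p))
    }
    where
    open ℕₚ.≤-Reasoning
    rearrange : ∀ a g x → 1 + (a + g * x) ≡ (a + 1) + g * x
    rearrange = ℕ-Solver.solve-∀
    raise : ∀ {y} → opt + 1 ≤ y → c + comp ≤ W * #components R + G * y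
    raise {y} opt<y = begin
      c + comp                     ≤⟨ ℕₚ.+-mono-≤ c≤1 (unpaid bounded λ _ _ → cong (lookup N′)) ⟩
      1 + (W * #components (singletons ℓ k) + G * opt)
                                   ≤⟨ s≤s (ℕₚ.+-monoˡ-≤ (G * opt) (ℕₚ.*-monoʳ-≤ W (#components≤n (singletons ℓ k)))) ⟩
      1 + (W * n + G * opt)        ≡⟨ rearrange (W * n) G opt ⟩
      G + G * opt                  ≡⟨ ℕₚ.*-suc G opt ⟨
      G * suc opt                  ≤⟨ ℕₚ.*-monoʳ-≤ G (subst (_≤ y) (ℕₚ.+-comm opt 1) opt<y) ⟩
      G * y                        ≤⟨ ℕₚ.m≤n+m (G * y) _ ⟩
      W * #components R + G * y    ∎

  merge-drop : ∀ {R : Partition ℓ k} {u v c} → R u ≢ R v → c ≤ W →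
               c + W * #components (merge ℓ k u v R) ≤ W * #components R
  merge-drop {R} {u} {v} {c} Ru≢Rv c≤W = ℕₚ.≤-trans (ℕₚ.+-monoˡ-≤ (W * #components (merge ℓ k u v R)) c≤W)
    (ℕₚ.≤-trans (ℕₚ.≤-reflexive (sym (ℕₚ.*-suc W _))) (ℕₚ.*-monoʳ-≤ W (merge-#components Ru≢Rv)))

  merge-reachable : ∀ {M M′ R u v} → Reachable ℓ k M R → R u ≢ R v → Invariant ℓ k (merge ℓ k u v R) M′ →
                    Reachable ℓ k M′ (merge ℓ k u v R)
  merge-reachable reachable Ru≢Rv inv = record
    { idempotent = merge-idempotent ℓ k (Reachable.idempotent reachable) Ru≢Rv ; invariant = inv }

  free-transfer : ∀ (N N′ : Mapping ℓ k) {u v} → requestCost ℓ k N (u , v) + migrationCost ℓ k N N′ ≡ 0 →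
                  ∀ {R} → Invariant ℓ k R N → Invariant ℓ k R N′
  free-transfer N N′ {u} {v} free inv x y eq = trans (sym (same x)) (trans (inv x y eq) (same y))
    where same = no-migration⁻¹ N N′ (ℕₚ.m+n≡0⇒n≡0 (requestCost ℓ k N (u , v)) free)

  free-merge : ∀ (N N′ : Mapping ℓ k) {u v} → requestCost ℓ k N (u , v) + migrationCost ℓ k N N′ ≡ 0 →
               ∀ {R} → Invariant ℓ k R N → Invariant ℓ k (merge ℓ k u v R) N′
  free-merge N N′ {u} {v} free inv = free-transfer N N′ free
    (merge-invariant N inv (free-request⁻¹ N (ℕₚ.m+n≡0⇒m≡0 (requestCost ℓ k N (u , v)) free)))

  bounded : ∀ {T M p R} {rs : Vec (Request ℓ k) T} {Ms} → Run ℓ k (COMP ℓ k) ⟨ M , p , R ⟩ rs Ms →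
            Reachable ℓ k M R → ∀ N Ns → All (Valid ℓ k) Ns → Bounded R N (cost ℓ k M rs Ms) (cost ℓ k N rs Ns)
  bounded [] reachable N [] [] = record { unpaid = λ _ → z≤n ; paid = z≤n }
  bounded {M = M} (same-component {R = R} {u} {v} Ru≡Rv ∷ run) reachable N (N′ ∷ Ns) (_ ∷ valids) =
    advance {N′ = N′} (ℕₚ.≤-reflexive (cong (_+ W * #components R) (cong₂ _+_ (free-request M (Reachable.invariant reachable u v Ru≡Rv)) (no-migration M))))
      (λ free → free-transfer N N′ free)
      (bounded run reachable N′ Ns valids)
  bounded {M = M} (same-cluster {R = R} {u} {v} Ru≢Rv Mu≡Mv ∷ run) reachable N (N′ ∷ Ns) (_ ∷ valids) =
    advance {N′ = N′} (merge-drop Ru≢Rv (ℕₚ.≤-trans (ℕₚ.≤-reflexive (cong₂ _+_ (free-request M Mu≡Mv) (no-migration M))) z≤n))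
      (λ free → free-merge N N′ free)
      (bounded run (merge-reachable reachable Ru≢Rv (merge-invariant M (Reachable.invariant reachable) Mu≡Mv)) N′ Ns valids)
  bounded {M = M} (remap {p = p} {R} {u} {v} {M′} Ru≢Rv Mu≢Mv best ∷ run) reachable N (N′ ∷ Ns) (_ ∷ valids) =
    advance {N′ = N′} (merge-drop Ru≢Rv (ℕₚ.+-mono-≤ (requestCost≤1 M (u , v))
        (ℕₚ.≤-trans (migration≤ M M′ p) (ℕₚ.*-monoʳ-≤ k (ℕₚ.<⇒≤ (remap-small {ℓ} {k} 0<k {M} {M′} p reachable Ru≢Rv Mu≢Mv best))))))
      (λ free → free-merge N N′ free)
      (bounded run (merge-reachable reachable Ru≢Rv (proj₂ (proj₁ best))) N′ Ns valids)
  bounded {M = M} (new-phase {u = u} {v} Ru≢Rv Mu≢Mv none ∷ run) reachable N (N′ ∷ Ns) (valid′ ∷ valids) =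
    restart {N′ = N′} (ℕₚ.≤-trans (ℕₚ.≤-reflexive (cong (λ x → requestCost ℓ k M (u , v) + x) (no-migration M)))
        (ℕₚ.≤-trans (ℕₚ.≤-reflexive (ℕₚ.+-identityʳ _)) (requestCost≤1 M (u , v))))
      -- If the offline step were free, `N′` would be a valid mapping respecting the merged
      -- partition, and the phase would not have ended.
      (λ inv free → none (N′ , valid′ , free-merge N N′ free inv))
      (bounded run (record { idempotent = λ _ → refl ; invariant = λ _ _ → cong (lookup M) }) N′ Ns valids)

  -- The additive term is the potential with which the first phase starts.
  COMP≤ : (I : Input ℓ k) → let open Input I in ∀ Ms →
          Run ℓ k (COMP ℓ k) ⟨ initial , initial-valid , singletons ℓ k ⟩ requests Ms →
          cost ℓ k initial requests Ms ≤ G * OPT ℓ k I + W * n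
  COMP≤ I Ms run with proj₁ (proj₂ (optimalCost ℓ k initial initial-valid requests))
    where open Input I
  ... | Ns , valids , cost≡OPT = begin
    cost ℓ k initial requests Ms
      ≤⟨ unpaid (bounded run (record { idempotent = λ _ → refl ; invariant = λ _ _ → cong (lookup initial) }) initial Ns valids)
           (λ _ _ → cong (lookup initial)) ⟩
    W * #components (singletons ℓ k) + G * cost ℓ k initial requests Ns
      ≤⟨ ℕₚ.+-mono-≤ (ℕₚ.*-monoʳ-≤ W (#components≤n (singletons ℓ k))) (ℕₚ.≤-reflexive (cong (G *_) cost≡OPT)) ⟩
    W * n + G * OPT ℓ k I
      ≡⟨ ℕₚ.+-comm (W * n) _ ⟩
    G * OPT ℓ k I + W * n ∎
    where
    open Input I
    open ℕₚ.≤-Reasoning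

  -- Estimates in powers of 2^k

  module _ (0<ℓ : 0 < ℓ) where
    X : ℕ
    X = 2 ^ k

    2≤X : 2 ≤ X
    2≤X = ℕₚ.^-monoʳ-≤ 2 0<k

    instance
      X≢0 : ℕ.NonZero X
      X≢0 = ℕₚ.m^n≢0 2 k

    2^≡X^ : ∀ m → 2 ^ (m * k) ≡ X ^ m
    2^≡X^ m = trans (cong (2 ^_) (ℕₚ.*-comm m k)) (sym (ℕₚ.^-*-assoc 2 k m))

    absorb : ∀ {a b} m → a ≤ X ^ m → b ≤ X ^ m → a + b ≤ X ^ suc m
    absorb {a} {b} m a≤ b≤ = ℕₚ.≤-trans (ℕₚ.+-mono-≤ a≤ (ℕₚ.≤-trans b≤ (ℕₚ.≤-reflexive (sym (ℕₚ.+-identityʳ (X ^ m))))))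
      (ℕₚ.*-monoˡ-≤ (X ^ m) 2≤X)

    multiply : ∀ {a b} m m′ → a ≤ X ^ m → b ≤ X ^ m′ → a * b ≤ X ^ (m + m′)
    multiply m m′ a≤ b≤ = ℕₚ.≤-trans (ℕₚ.*-mono-≤ a≤ b≤) (ℕₚ.≤-reflexive (sym (ℕₚ.^-distribˡ-+-* X m m′)))

    n≤2^n : ∀ n → n ≤ 2 ^ n
    n≤2^n zero    = z≤n
    n≤2^n (suc n) = ℕₚ.+-mono-≤ (ℕₚ.m^n>0 2 n) (ℕₚ.≤-trans (n≤2^n n) (ℕₚ.≤-reflexive (sym (ℕₚ.+-identityʳ (2 ^ n)))))

    k≤X : ∀ m → 0 < m → k ≤ X ^ m
    k≤X (suc m) _ = ℕₚ.≤-trans (n≤2^n k) (ℕₚ.m≤m*n X (X ^ m) {{ℕₚ.m^n≢0 X m}})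

    N≤ : N ≤ X ^ 5
    N≤ = ℕₚ.≤-trans (#lightVectors≤ k 0<k) (ℕₚ.≤-reflexive (2^≡X^ 5))

    B≤ : B ≤ X ^ 14
    -- `N * N` contributes the exponent 10 and the factor 8 = 2³ contributes 3; the summand `k`
    -- raises the result by one more.
    B≤ = absorb 13 (k≤X 13 (s≤s z≤n)) (multiply 10 3 (multiply 5 5 N≤ N≤) (ℕₚ.^-monoˡ-≤ 3 2≤X))

    W≤ : W ≤ X ^ 16
    W≤ = absorb 15 (ℕₚ.m^n>0 X 15) (multiply 1 14 (k≤X 1 (s≤s z≤n)) B≤)

    G≤ : G ≤ ℓ * 2 ^ (18 * k)
    G≤ = begin
      W * (ℓ * k) + 1                 ≡⟨ cong (_+ 1) (swap W ℓ k) ⟩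
      ℓ * (W * k) + 1                 ≤⟨ ℕₚ.+-monoʳ-≤ (ℓ * (W * k)) (ℕₚ.≤-trans 0<ℓ (ℕₚ.≤-reflexive (sym (ℕₚ.*-identityʳ ℓ)))) ⟩
      ℓ * (W * k) + ℓ * 1             ≡⟨ ℕₚ.*-distribˡ-+ ℓ (W * k) 1 ⟨
      ℓ * (W * k + 1)                 ≤⟨ ℕₚ.*-monoʳ-≤ ℓ (absorb 17 (multiply 16 1 W≤ (k≤X 1 (s≤s z≤n))) (ℕₚ.m^n>0 X 17)) ⟩
      ℓ * X ^ 18                      ≡⟨ cong (ℓ *_) (2^≡X^ 18) ⟨
      ℓ * 2 ^ (18 * k)                ∎
      where
      open ℕₚ.≤-Reasoning
      swap : ∀ w l k → w * (l * k) ≡ l * (w * k)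
      swap = ℕ-Solver.solve-∀

theorem1 : Σ[ C ∈ ℕ ] (0 < C × (∀ (ℓ k : ℕ) → 0 < ℓ → 0 < k → Competitive ℓ k (COMP ℓ k) (ℓ * 2 ^ (C * k))))
theorem1 = 18 , s≤s z≤n , λ ℓ k 0<ℓ 0<k → let open Competitiveness {ℓ} 0<k in
  W * n , λ I Ms run → ℕₚ.≤-trans (COMP≤ I Ms run) (ℕₚ.+-monoˡ-≤ (W * n) (ℕₚ.*-monoˡ-≤ (OPT ℓ k I) (G≤ 0<ℓ)))
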